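{- Let $r$ and $s$ be positive integers and let $G$ be a graph of order $n=3r+4s$ with $\sigma_2(G)\geq n+r$. Then $G$ contains $r$ triangles, $s-1$ quadrilaterals ($4$-cycles), and a subgraph $D$ of order $4$ with at least $4$ edges, all pairwise vertex-disjoint.
   Context: All graphs are finite, simple and undirected. $\sigma_2(G)=\min\{d(x)+d(y): x,y\in V(G),\ x\neq y,\ xy\notin E(G)\}$, where $d(x)$ is the degree of $x$; if $G$ is complete, $\sigma_2(G)=\infty$. -}

module Defs where

open import Data.Nat using (ℕ; _+_; _*_; _≤_)
open import Data.Fin using (Fin; zero; suc)
open import Data.Fin.Subset using (Subset; ∣_∣)
open import Data.Vec using (tabulate)
open import Data.Bool using (Bool; if_then_else_)
open import Data.Product using (_×_; Σ; _,_)
open import Data.Sum using (_⊎_; inj₁; inj₂)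
open import Relation.Nullary using (¬_; Dec)
open import Relation.Nullary.Decidable using (⌊_⌋)
open import Relation.Binary.PropositionalEquality using (_≡_; _≢_)
open import Function.Definitions using (Injective)

record Graph (n : ℕ) : Set₁ where
  field
    Adj     : Fin n → Fin n → Set
    adj?    : ∀ x y → Dec (Adj x y)
    sym     : ∀ {x y} → Adj x y → Adj y x
    irrefl  : ∀ {x} → ¬ Adj x x

open Graph public

nbhd : ∀ {n} → Graph n → Fin n → Subset n
nbhd G x = tabulate (λ y → ⌊ adj? G x y ⌋)

deg : ∀ {n} → Graph n → Fin n → ℕ
deg G x = ∣ nbhd G x ∣

-- σ₂(G) ≥ k : every pair of distinct non-adjacent vertices has degree sum ≥ k
-- (vacuous for complete graphs, matching σ₂ = ∞)
σ₂≥ : ∀ {n} → Graph n → ℕ → Set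
σ₂≥ G k = ∀ x y → x ≢ y → ¬ Adj G x y → k ≤ deg G x + deg G y

-- a triangle given by its vertex map Fin 3 → V (distinctness via global injectivity)
IsTriangle : ∀ {n} → Graph n → (Fin 3 → Fin n) → Set
IsTriangle G t =
  Adj G (t zero) (t (suc zero)) ×
  Adj G (t (suc zero)) (t (suc (suc zero))) ×
  Adj G (t (suc (suc zero))) (t zero)

IsQuadrilateral : ∀ {n} → Graph n → (Fin 4 → Fin n) → Set
IsQuadrilateral G q =
  Adj G (q zero) (q (suc zero)) ×
  Adj G (q (suc zero)) (q (suc (suc zero))) ×
  Adj G (q (suc (suc zero))) (q (suc (suc (suc zero)))) ×
  Adj G (q (suc (suc (suc zero)))) (q zero)

-- number of edges of G among the vertices d 0, d 1, d 2, d 3 (assumed distinct):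
-- the number of pairs i < j with d i adjacent to d j
edgesAmong4 : ∀ {n} → Graph n → (Fin 4 → Fin n) → ℕ
edgesAmong4 G d =
  b (d v0) (d v1) + b (d v0) (d v2) + b (d v0) (d v3) +
  b (d v1) (d v2) + b (d v1) (d v3) + b (d v2) (d v3)
  where
    v0 v1 v2 v3 : Fin 4
    v0 = zero
    v1 = suc zero
    v2 = suc (suc zero)
    v3 = suc (suc (suc zero))
    b : Fin _ → Fin _ → ℕ
    b x y = if ⌊ adj? G x y ⌋ then 1 else 0

allVerts : ∀ {n r m} → (Fin r → Fin 3 → Fin n) → (Fin m → Fin 4 → Fin n) →
           (Fin 4 → Fin n) →
           (Σ (Fin r) (λ _ → Fin 3) ⊎ Σ (Fin m) (λ _ → Fin 4)) ⊎ Fin 4 → Fin n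
allVerts t q d (inj₁ (inj₁ (i , k))) = t i k
allVerts t q d (inj₁ (inj₂ (j , k))) = q j k
allVerts t q d (inj₂ k) = d k

-- the disjoint family: r triangles, m quadrilaterals, one 4-vertex subgraph D
-- with at least 4 edges, all pairwise vertex-disjoint (the combined vertex map
-- on the disjoint union of all vertex slots is injective, which also makes the
-- vertices within each triangle / quadrilateral / D distinct)
record Packing {n} (G : Graph n) (r m : ℕ) : Set where
  field
    tri  : Fin r → Fin 3 → Fin n
    quad : Fin m → Fin 4 → Fin n
    D    : Fin 4 → Fin n
    triOK  : ∀ i → IsTriangle G (tri i)
    quadOK : ∀ j → IsQuadrilateral G (quad j)
    DOK    : 4 ≤ edgesAmong4 G D
    disjoint : Injective _≡_ _≡_ (allVerts tri quad D)

{-# OPTIONS --safe #-}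
-- Work with states consisting of disjoint triangles, disjoint quadrilaterals and a few uncovered
-- vertices. Since the degree condition is preserved when edges are added, we may delete edges
-- from the complete graph one at a time: it suffices to find the subgraphs in G when they exist
-- in G + xy. Only the block containing x can be damaged, so in G there is a packing in which one
-- triangle or quadrilateral has been replaced by a path, or D has lost an edge.
--
-- Such a near-packing is improved step by step. Pick c pairs of non-adjacent uncovered vertices.
-- Their degrees sum to at least 4c(r + s), so there is a triangle or quadrilateral B receiving
-- more than 4c edges from them, or the uncovered vertices span too many edges themselves. In
-- each case B and the uncovered vertices can be rearranged into a better state. The states are,
-- from worst to best: a path instead of a triangle (path₃, and path₃ plus a triangle attached to
-- its ends, fan), a path and a paw instead of two quadrilaterals (paw∪path), and then r
-- triangles, s − 1 quadrilaterals and four vertices spanning at least 0 edges, an edge, two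
-- disjoint edges, a path on three vertices, a claw, a path on four vertices, a triangle, and
-- finally a paw or a quadrilateral. The rearrangements are a finite problem about at most twelve
-- vertices, which is settled by a verified search.
module Submission where

open import Defs hiding (sym)
open import Data.Bool using (Bool; true; false; if_then_else_; _∧_; _∨_; not)
open import Data.Bool.Properties using (T-≡; ∨-comm; ∧-comm; ∨-zeroʳ)
open import Data.Fin using (Fin; zero; suc; _≟_; _↑ˡ_; _↑ʳ_)
open import Data.Fin.Patterns using (0F; 1F; 2F; 3F)
open import Data.Fin.Subset using (∣_∣)
open import Data.List using (List; []; _∷_; _++_; map; length; concatMap; allFin; tabulate; cartesianProduct; lookup)
open import Data.List.Membership.Propositional using (_∈_)
open import Data.List.Membership.Propositional.Properties using (∈-allFin; ∈-cartesianProduct⁺; ∈-lookup)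
open import Data.List.Properties using (map-∘; map-cong; map-++; length-map; length-++; length-tabulate; ++-assoc)
open import Data.List.Relation.Binary.Permutation.Propositional using (_↭_; refl; prep; swap; trans; ↭-refl; ↭-reflexive; ↭-sym; ↭-trans; ↭⇒↭ₛ)
open import Data.List.Relation.Binary.Permutation.Propositional.Properties using (↭-length; map⁺; ++⁺ʳ; ++-comm; ∈-resp-↭)
import Data.List.Relation.Binary.Permutation.Setoid.Properties as Permₛ
open import Data.List.Relation.Unary.All as All using (All; []; _∷_)
open import Data.List.Relation.Unary.AllPairs using ([]; _∷_)
open import Data.List.Relation.Unary.Any using (Any; here; there)
import Data.List.Relation.Unary.Any.Properties as Any
open import Data.List.Relation.Unary.Unique.Propositional using (Unique)
open import Data.List.Relation.Unary.Unique.Propositional.Properties using (allFin⁺)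
open import Data.Maybe using (Maybe; just; nothing)
open import Data.Nat using (ℕ; zero; suc; _+_; _*_; _∸_; _⊓_; _/_; _%_; _≤_; _<_; _≡ᵇ_; _<ᵇ_; _<?_; z≤n; s≤s)
open import Data.Nat.Properties hiding (_≟_)
open import Data.Nat.Tactic.RingSolver using (solve-∀)
open import Data.Product using (_×_; _,_; proj₁; proj₂; Σ; ∃)
open import Data.Sum using (_⊎_; inj₁; inj₂)
import Data.Vec as Vec
open import Function using (_∘_; id; Equivalence)
open import Function.Definitions using (Injective)
open import Relation.Binary.PropositionalEquality as ≡ using (_≡_; _≢_; refl; sym; cong; cong₂; subst)
open import Relation.Nullary using (contradiction; yes; no)
open import Relation.Nullary.Decidable using (⌊_⌋)

-- Boolean and arithmetic preliminaries

≡ᵇ-true : ∀ i j → (i ≡ᵇ j) ≡ true → i ≡ j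
≡ᵇ-true i j eq = ≡ᵇ⇒≡ i j (Equivalence.from T-≡ eq)

∧-true : ∀ x {y} → x ∧ y ≡ true → x ≡ true × y ≡ true
∧-true true eq = refl , eq

<ᵇ-true : ∀ i j → (i <ᵇ j) ≡ true → i < j
<ᵇ-true i j eq = <ᵇ⇒< i j (Equivalence.from T-≡ eq)

-- Closes every branch of the search in which the edges known to be absent cost more than the budget
-- allows.
overdrawn : ∀ {X : Set} b c {l} → (b <ᵇ c) ≡ true → c + l ≤ b → X
overdrawn b c lt le = contradiction (≤-trans (m≤m+n c _) le) (<⇒≱ (<ᵇ-true b c lt))

+-swap : ∀ a b c → a + (b + c) ≡ b + (a + c)
+-swap = solve-∀

+-interchange : ∀ a b c d → (a + b) + (c + d) ≡ (a + c) + (b + d)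
+-interchange = solve-∀

-- Searching for an edge pattern under a bound on the number of absent edges

elem : ℕ → List ℕ → Bool
elem e [] = false
elem e (x ∷ xs) = if e ≡ᵇ x then true else elem e xs

inc : ℕ × List ℕ → ℕ × List ℕ
inc (c , ws) = suc c , ws

keep : ℕ → ℕ × List ℕ → ℕ × List ℕ
keep x (c , ws) = c , x ∷ ws

-- The first component is the multiplicity of the edge: a vertex of weight two makes its edges occur
-- twice, and the absence of such an edge costs two.
remove : ℕ → List ℕ → ℕ × List ℕ
remove e [] = 0 , []
remove e (x ∷ ws) = if e ≡ᵇ x then inc (remove e ws) else keep x (remove e ws)

atMost : ℕ → ℕ × List ℕ → ℕ × List ℕ
atMost c (d , ws) = c ⊓ d , ws

-- The first component never exceeds the multiplicity of any edge of the pattern, so it is lost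
-- whichever edge is absent. The second drops all edges of the pattern, so that later charges
-- concern other edges.
cost : List ℕ → List ℕ → ℕ × List ℕ
costAfter : List ℕ → ℕ × List ℕ → ℕ × List ℕ
-- An empty pattern is never absent, so any number is sound here; it enters the minimum as a cap.
cost [] ws = length ws , ws
cost (e ∷ p) ws = costAfter p (remove e ws)
costAfter p (c , ws) = atMost c (cost p ws)

meets : List ℕ → List ℕ → Bool
meets [] us = false
meets (e ∷ p) us = if elem e us then true else meets p us

-- Absent patterns cost a missing edge each, so disjoint ones bound the loss from below.
packs : List (List ℕ) → List ℕ → List ℕ → ℕ → Bool
packsAfter : List (List ℕ) → List ℕ → ℕ → ℕ × List ℕ → Bool
packs [] us ws b = false
packs (p ∷ ps) us ws b = if meets p us then packs ps us ws b else packsAfter ps (p ++ us) b (cost p ws)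
packsAfter ps us b (c , ws) = if b <ᵇ c then true else packs ps us ws (b ∸ c)

-- Short patterns come first because they give the fewest branches and are packed first. An empty
-- pattern is present outright, so it alone is kept.
bucket : (ps p₁ p₂ p₃ p₄ : List (List ℕ)) → List (List ℕ)
bucket [] p₁ p₂ p₃ p₄ = p₁ ++ p₂ ++ p₃ ++ p₄
bucket ([] ∷ ps) p₁ p₂ p₃ p₄ = [] ∷ []
bucket (p@(_ ∷ []) ∷ ps) p₁ p₂ p₃ p₄ = bucket ps (p ∷ p₁) p₂ p₃ p₄
bucket (p@(_ ∷ _ ∷ []) ∷ ps) p₁ p₂ p₃ p₄ = bucket ps p₁ (p ∷ p₂) p₃ p₄
bucket (p@(_ ∷ _ ∷ _ ∷ []) ∷ ps) p₁ p₂ p₃ p₄ = bucket ps p₁ p₂ (p ∷ p₃) p₄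
bucket (p@(_ ∷ _ ∷ _ ∷ _ ∷ _) ∷ ps) p₁ p₂ p₃ p₄ = bucket ps p₁ p₂ p₃ (p ∷ p₄)

del : ℕ → List ℕ → List ℕ
del e [] = []
del e (x ∷ p) = if e ≡ᵇ x then del e p else x ∷ del e p

onTrue onFalse : ℕ → List (List ℕ) → List (List ℕ)
onTrue e [] = []
onTrue e (p ∷ ps) = del e p ∷ onTrue e ps
onFalse e [] = []
onFalse e (p ∷ ps) = if elem e p then onFalse e ps else p ∷ onFalse e ps

-- search f ws b ps looks for a pattern of ps when at most b members of the multiset ws of
-- edges are absent: it branches on the edges of a shortest pattern, charging absent edges
-- to the budget b.
search : ℕ → List ℕ → ℕ → List (List ℕ) → Bool
explore : ℕ → List ℕ → ℕ → List (List ℕ) → Bool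
branch : ℕ → List ℕ → ℕ → List ℕ → List (List ℕ) → Bool
without : ℕ → ℕ × List ℕ → ℕ → List (List ℕ) → Bool
search zero ws b ps = false
search (suc f) ws b ps = explore f ws b (bucket ps [] [] [] [])
explore f ws b [] = false
explore f ws b (p ∷ ps) = if packs (p ∷ ps) [] ws b then true else branch f ws b p (p ∷ ps)
branch f ws b [] ps = true
-- The first conjunct is the case in which `e` is the first absent edge of the chosen pattern; the
-- edges before it have been erased from `ps` as present.
branch f ws b (e ∷ p) ps = without f (remove e ws) b (onFalse e ps) ∧ branch f ws b p (onTrue e ps)
without f (c , ws) b ps = if b <ᵇ c then true else search f ws (b ∸ c) ps

-- Soundness of the search

module _ (a : ℕ → Bool) where

  Present : List ℕ → Set
  Present = All (λ e → a e ≡ true)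

  loss : List ℕ → ℕ
  loss [] = 0
  loss (e ∷ ws) = (if a e then 0 else 1) + loss ws

  remove-true : ∀ e ws → a e ≡ true → loss (proj₂ (remove e ws)) ≡ loss ws
  remove-true e [] ae = refl
  remove-true e (x ∷ ws) ae with e ≡ᵇ x in eq
  ... | false = cong ((if a x then 0 else 1) +_) (remove-true e ws ae)
  ... | true rewrite sym (≡ᵇ-true e x eq) | ae = remove-true e ws ae

  remove-false : ∀ e ws → a e ≡ false → proj₁ (remove e ws) + loss (proj₂ (remove e ws)) ≡ loss ws
  remove-false e [] ae = refl
  remove-false e (x ∷ ws) ae with e ≡ᵇ x in eq
  ... | true rewrite sym (≡ᵇ-true e x eq) | ae = cong suc (remove-false e ws ae)
  ... | false = ≡.trans (+-swap (proj₁ (remove e ws)) (if a x then 0 else 1) _)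
                      (cong ((if a x then 0 else 1) +_) (remove-false e ws ae))

  remove-≤ : ∀ e ws → loss (proj₂ (remove e ws)) ≤ loss ws
  remove-≤ e ws with a e in ae
  ... | true = ≤-reflexive (remove-true e ws ae)
  ... | false = ≤-trans (m≤n+m _ _) (≤-reflexive (remove-false e ws ae))

  cost-≤ : ∀ p ws → loss (proj₂ (cost p ws)) ≤ loss ws
  cost-≤ [] ws = ≤-refl
  cost-≤ (e ∷ p) ws = ≤-trans (cost-≤ p (proj₂ (remove e ws))) (remove-≤ e ws)

  -- The first absent edge of the pattern already accounts for the bound: its multiplicity is at
  -- least the minimum, and removing further edges cannot increase the loss.
  cost-sound : ∀ p ws → Present p ⊎ proj₁ (cost p ws) + loss (proj₂ (cost p ws)) ≤ loss ws
  cost-sound [] ws = inj₁ []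
  cost-sound (e ∷ p) ws with a e in ae
  ... | false = inj₂ (≤-trans
          (+-mono-≤ (m⊓n≤m (proj₁ (remove e ws)) _) (cost-≤ p (proj₂ (remove e ws))))
          (≤-reflexive (remove-false e ws ae)))
  ... | true with cost-sound p (proj₂ (remove e ws))
  ...   | inj₁ q = inj₁ (ae ∷ q)
  ...   | inj₂ le = inj₂ (≤-trans (+-monoˡ-≤ _ (m⊓n≤n (proj₁ (remove e ws)) _))
                           (≤-trans le (remove-≤ e ws)))

  shrink : ∀ {c l l′ b} → c + l ≤ l′ → l′ ≤ b → l ≤ b ∸ c
  shrink {c} {l} le le′ = subst (_≤ _) (m+n∸m≡n c l) (∸-monoˡ-≤ c (≤-trans le le′))

  -- Each pattern met is either present or pays for its absence. The edges paid for leave `ws`, so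
  -- no absence is charged twice.
  packs-sound : ∀ ps us ws b → packs ps us ws b ≡ true → loss ws ≤ b → Any Present ps
  packs-sound (p ∷ ps) us ws b eq le with meets p us
  ... | true = there (packs-sound ps us ws b eq le)
  ... | false with cost-sound p ws
  ...   | inj₁ pr = here pr
  ...   | inj₂ le′ with b <ᵇ proj₁ (cost p ws) in lt
  ...     | true = overdrawn b (proj₁ (cost p ws)) lt (≤-trans le′ le)
  ...     | false = there (packs-sound ps (p ++ us) (proj₂ (cost p ws)) _ eq (shrink le′ le))

  bucket-sound : ∀ ps p₁ p₂ p₃ p₄ → Any Present (bucket ps p₁ p₂ p₃ p₄) →
                 Any Present ps ⊎ Any Present (p₁ ++ p₂ ++ p₃ ++ p₄)
  bucket-sound [] p₁ p₂ p₃ p₄ s = inj₂ s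
  bucket-sound ([] ∷ ps) p₁ p₂ p₃ p₄ (here pr) = inj₁ (here pr)
  bucket-sound (p@(_ ∷ []) ∷ ps) p₁ p₂ p₃ p₄ s with bucket-sound ps (p ∷ p₁) p₂ p₃ p₄ s
  ... | inj₁ t = inj₁ (there t)
  ... | inj₂ (here t) = inj₁ (here t)
  ... | inj₂ (there t) = inj₂ t
  bucket-sound (p@(_ ∷ _ ∷ []) ∷ ps) p₁ p₂ p₃ p₄ s with bucket-sound ps p₁ (p ∷ p₂) p₃ p₄ s
  ... | inj₁ t = inj₁ (there t)
  ... | inj₂ t with Any.++⁻ p₁ t
  ...   | inj₁ u = inj₂ (Any.++⁺ˡ u)
  ...   | inj₂ (here u) = inj₁ (here u)
  ...   | inj₂ (there u) = inj₂ (Any.++⁺ʳ p₁ u)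
  bucket-sound (p@(_ ∷ _ ∷ _ ∷ []) ∷ ps) p₁ p₂ p₃ p₄ s with bucket-sound ps p₁ p₂ (p ∷ p₃) p₄ s
  ... | inj₁ t = inj₁ (there t)
  ... | inj₂ t with Any.++⁻ p₁ t
  ...   | inj₁ u = inj₂ (Any.++⁺ˡ u)
  ...   | inj₂ u with Any.++⁻ p₂ u
  ...     | inj₁ w = inj₂ (Any.++⁺ʳ p₁ (Any.++⁺ˡ w))
  ...     | inj₂ (here w) = inj₁ (here w)
  ...     | inj₂ (there w) = inj₂ (Any.++⁺ʳ p₁ (Any.++⁺ʳ p₂ w))
  bucket-sound (p@(_ ∷ _ ∷ _ ∷ _ ∷ _) ∷ ps) p₁ p₂ p₃ p₄ s with bucket-sound ps p₁ p₂ p₃ (p ∷ p₄) s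
  ... | inj₁ t = inj₁ (there t)
  ... | inj₂ t with Any.++⁻ p₁ t
  ...   | inj₁ u = inj₂ (Any.++⁺ˡ u)
  ...   | inj₂ u with Any.++⁻ p₂ u
  ...     | inj₁ w = inj₂ (Any.++⁺ʳ p₁ (Any.++⁺ˡ w))
  ...     | inj₂ w with Any.++⁻ p₃ w
  ...       | inj₁ z = inj₂ (Any.++⁺ʳ p₁ (Any.++⁺ʳ p₂ (Any.++⁺ˡ z)))
  ...       | inj₂ (here z) = inj₁ (here z)
  ...       | inj₂ (there z) = inj₂ (Any.++⁺ʳ p₁ (Any.++⁺ʳ p₂ (Any.++⁺ʳ p₃ z)))

  del⁺ : ∀ e p → Present p → Present (del e p)
  del⁺ e [] [] = []
  del⁺ e (x ∷ p) (px ∷ pp) with e ≡ᵇ x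
  ... | true = del⁺ e p pp
  ... | false = px ∷ del⁺ e p pp

  del⁻ : ∀ e p → a e ≡ true → Present (del e p) → Present p
  del⁻ e [] ae q = []
  del⁻ e (x ∷ p) ae q with e ≡ᵇ x in eq
  del⁻ e (x ∷ p) ae q | true = subst (λ y → a y ≡ true) (≡ᵇ-true e x eq) ae ∷ del⁻ e p ae q
  del⁻ e (x ∷ p) ae (px ∷ q) | false = px ∷ del⁻ e p ae q

  onTrue⁺ : ∀ e ps → Any Present ps → Any Present (onTrue e ps)
  onTrue⁺ e (p ∷ ps) (here pr) = here (del⁺ e p pr)
  onTrue⁺ e (p ∷ ps) (there s) = there (onTrue⁺ e ps s)

  onTrue⁻ : ∀ e ps → a e ≡ true → Any Present (onTrue e ps) → Any Present ps
  onTrue⁻ e (p ∷ ps) ae (here pr) = here (del⁻ e p ae pr)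
  onTrue⁻ e (p ∷ ps) ae (there s) = there (onTrue⁻ e ps ae s)

  onFalse⁻ : ∀ e ps → Any Present (onFalse e ps) → Any Present ps
  onFalse⁻ e (p ∷ ps) s with elem e p
  onFalse⁻ e (p ∷ ps) s | true = there (onFalse⁻ e ps s)
  onFalse⁻ e (p ∷ ps) (here pr) | false = here pr
  onFalse⁻ e (p ∷ ps) (there s) | false = there (onFalse⁻ e ps s)

  search-sound : ∀ f ws b ps → search f ws b ps ≡ true → loss ws ≤ b → Any Present ps
  explore-sound : ∀ f ws b ps → explore f ws b ps ≡ true → loss ws ≤ b → Any Present ps
  -- The hypothesis on `p` is the invariant that the unread edges of the chosen pattern complete a
  -- member of the restricted family. It holds at first because the pattern heads the family, and
  -- `onTrue` preserves it.
  branch-sound : ∀ f ws b p ps → (Present p → Any Present ps) →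
                 branch f ws b p ps ≡ true → loss ws ≤ b → Any Present ps
  without-sound : ∀ f c ws b ps → without f (c , ws) b ps ≡ true → c + loss ws ≤ b → Any Present ps
  search-sound (suc f) ws b ps eq le
    with bucket-sound ps [] [] [] [] (explore-sound f ws b (bucket ps [] [] [] []) eq le)
  ... | inj₁ s = s
  explore-sound f ws b (p ∷ ps) eq le with packs (p ∷ ps) [] ws b in pk
  ... | true = packs-sound (p ∷ ps) [] ws b pk le
  ... | false = branch-sound f ws b p (p ∷ ps) here eq le
  branch-sound f ws b [] ps h eq le = h []
  branch-sound f ws b (e ∷ p) ps h eq le
    with ∧-true (without f (remove e ws) b (onFalse e ps)) eq | a e in ae
  ... | eq₁ , _ | false = onFalse⁻ e ps
          (without-sound f _ _ b _ eq₁ (≤-trans (≤-reflexive (remove-false e ws ae)) le))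
  ... | _ , eq₂ | true = onTrue⁻ e ps ae
          (branch-sound f ws b p (onTrue e ps) (λ pr → onTrue⁺ e ps (h (ae ∷ pr))) eq₂ le)
  without-sound f c ws b ps eq le with b <ᵇ c in lt
  ... | true = overdrawn b c lt le
  ... | false = search-sound f ws (b ∸ c) ps eq (shrink {c} le ≤-refl)

searchGiven : List ℕ → List ℕ → ℕ → List (List ℕ) → Bool
searchAfter : List ℕ → ℕ × List ℕ → ℕ → List (List ℕ) → Bool
-- The fuel bounds how many absent edges are assumed along one branch. Running out answers `false`,
-- which claims nothing.
searchGiven [] ws b ps = search 64 ws b ps
searchGiven (e ∷ es) ws b ps = searchAfter es (remove e ws) b ps
searchAfter es (c , ws) b ps = if b <ᵇ c then true else searchGiven es ws (b ∸ c) ps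

searchGiven-sound : ∀ a es ws b ps → All (λ e → a e ≡ false) es → searchGiven es ws b ps ≡ true →
                    loss a ws ≤ b → Any (Present a) ps
searchGiven-sound a [] ws b ps [] eq le = search-sound a 64 ws b ps eq le
searchGiven-sound a (e ∷ es) ws b ps (ae ∷ aes) eq le with b <ᵇ proj₁ (remove e ws) in lt
... | true = overdrawn b (proj₁ (remove e ws)) lt (≤-trans (≤-reflexive (remove-false a e ws ae)) le)
... | false = searchGiven-sound a es _ _ ps aes eq
      (shrink a {proj₁ (remove e ws)} (≤-reflexive (remove-false a e ws ae)) le)

-- Labels, permutations and codes of vertex pairs

range : ℕ → ℕ → List ℕ
range o zero = []
range o (suc k) = o ∷ range (suc o) k

map-range : ∀ {X : Set} (f : ℕ → X) o i k → map f (range (o + i) k) ≡ map (f ∘ (o +_)) (range i k)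
map-range f o i zero = refl
map-range f o i (suc k) = cong (f (o + i) ∷_)
  (≡.trans (cong (λ j → map f (range j k)) (sym (+-suc o i))) (map-range f o (suc i) k))

nth : List ℕ → ℕ → ℕ
nth [] i = 0
nth (x ∷ xs) zero = x
nth (x ∷ xs) (suc i) = nth xs i

map-nth : ∀ {X : Set} (f : ℕ → X) xs → map (f ∘ nth xs) (range 0 (length xs)) ≡ map f xs
map-nth f [] = refl
map-nth f (x ∷ xs) = cong (f x ∷_)
  (≡.trans (map-range (f ∘ nth (x ∷ xs)) 1 0 (length xs)) (map-nth f xs))

extract : ℕ → List ℕ → Maybe (List ℕ)
keepJust : ℕ → Maybe (List ℕ) → Maybe (List ℕ)
keepJust y nothing = nothing
keepJust y (just zs) = just (y ∷ zs)
extract x [] = nothing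
extract x (y ∷ ys) = if x ≡ᵇ y then just ys else keepJust y (extract x ys)

perm? : List ℕ → List ℕ → Bool
permAfter : List ℕ → Maybe (List ℕ) → Bool
perm? [] [] = true
perm? [] (_ ∷ _) = false
perm? (x ∷ xs) ys = permAfter xs (extract x ys)
permAfter xs nothing = false
permAfter xs (just zs) = perm? xs zs

extract-sound : ∀ x ys zs → extract x ys ≡ just zs → x ∷ zs ↭ ys
extract-sound x (y ∷ ys) zs eq with x ≡ᵇ y in xy
extract-sound x (y ∷ ys) .ys refl | true rewrite ≡ᵇ-true x y xy = ↭-refl
extract-sound x (y ∷ ys) zs eq | false with extract x ys in ex
extract-sound x (y ∷ ys) .(y ∷ ws) refl | false | just ws =
  ↭-trans (swap x y ↭-refl) (prep y (extract-sound x ys ws ex))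

perm-sound : ∀ xs ys → perm? xs ys ≡ true → xs ↭ ys
perm-sound [] [] eq = ↭-refl
perm-sound (x ∷ xs) ys eq with extract x ys in ex
... | just zs = ↭-trans (prep x (perm-sound xs zs eq)) (extract-sound x ys zs ex)

every : {X : Set} → (X → Bool) → List X → Bool
every f [] = true
every f (x ∷ xs) = f x ∧ every f xs

every-sound : ∀ {X : Set} (f : X → Bool) xs → every f xs ≡ true → All (λ x → f x ≡ true) xs
every-sound f [] eq = []
every-sound f (x ∷ xs) eq = let p , q = ∧-true (f x) eq in p ∷ every-sound f xs q

every-++ʳ : ∀ {X : Set} (f : X → Bool) xs {ys} → every f (xs ++ ys) ≡ true → every f ys ≡ true
every-++ʳ f [] eq = eq
every-++ʳ f (x ∷ xs) eq = every-++ʳ f xs (proj₂ (∧-true (f x) eq))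

-- For labels below 16 this is a two-digit hexadecimal number with the larger digit last, so both
-- orientations of an edge share one code.
code : ℕ → ℕ → ℕ
code i j = if i <ᵇ j then 16 * i + j else 16 * j + i

encodes : ℕ → ℕ → ℕ → Bool
encodes c i j = ((c / 16) ≡ᵇ i) ∧ ((c % 16) ≡ᵇ j)

-- Decoding is tested by evaluation on each pair that occurs, in place of a general theorem about
-- digits. Either order is accepted since adjacency is symmetric.
faithful : ℕ × ℕ → Bool
faithful (i , j) = if encodes (code i j) i j then true else encodes (code i j) j i

codes : List (ℕ × ℕ) → List ℕ
codes = map (λ e → code (proj₁ e) (proj₂ e))

pairings : List ℕ → List ℕ → List (ℕ × ℕ)
pairings us js = concatMap (λ u → map (u ,_) js) us

bit : Bool → ℕ
bit b = if b then 1 else 0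

-- Families of disjoint triangles and quadrilaterals

module Packings {n : ℕ} (A : Fin n → Fin n → Bool) where

  V : Set
  V = Fin n

  hits : V → List V → ℕ
  hits x [] = 0
  hits x (y ∷ ys) = bit (A x y) + hits x ys

  -- `us` may repeat vertices, so edges are counted with weights; with `ys` all vertices this is a
  -- weighted degree sum.
  total : List V → List V → ℕ
  total [] ys = 0
  total (u ∷ us) ys = hits u ys + total us ys

  hits-++ : ∀ x ys zs → hits x (ys ++ zs) ≡ hits x ys + hits x zs
  hits-++ x [] zs = refl
  hits-++ x (y ∷ ys) zs = ≡.trans (cong (_ +_) (hits-++ x ys zs))
    (sym (+-assoc (bit (A x y)) (hits x ys) (hits x zs)))

  total-++ : ∀ us ys zs → total us (ys ++ zs) ≡ total us ys + total us zs
  total-++ [] ys zs = refl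
  total-++ (u ∷ us) ys zs = ≡.trans (cong₂ _+_ (hits-++ u ys zs) (total-++ us ys zs))
    (+-interchange (hits u ys) (hits u zs) (total us ys) (total us zs))

  hits-↭ : ∀ x {ys zs} → ys ↭ zs → hits x ys ≡ hits x zs
  hits-↭ x refl = refl
  hits-↭ x (prep y p) = cong (_ +_) (hits-↭ x p)
  hits-↭ x (swap y z p) = ≡.trans (+-swap (bit (A x y)) (bit (A x z)) _)
    (cong (λ k → bit (A x z) + (bit (A x y) + k)) (hits-↭ x p))
  hits-↭ x (trans p q) = ≡.trans (hits-↭ x p) (hits-↭ x q)

  total-↭ : ∀ us {ys zs} → ys ↭ zs → total us ys ≡ total us zs
  total-↭ [] p = refl
  total-↭ (u ∷ us) p = cong₂ _+_ (hits-↭ u p) (total-↭ us p)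

  total-↭ˡ : ∀ {us vs} ys → us ↭ vs → total us ys ≡ total vs ys
  total-↭ˡ ys refl = refl
  total-↭ˡ ys (prep x p) = cong (_ +_) (total-↭ˡ ys p)
  total-↭ˡ ys (swap x y p) = ≡.trans (+-swap (hits x ys) (hits y ys) _)
    (cong (λ k → hits y ys + (hits x ys + k)) (total-↭ˡ ys p))
  total-↭ˡ ys (trans p q) = ≡.trans (total-↭ˡ ys p) (total-↭ˡ ys q)

  _~_ : V → V → Set
  x ~ y = A x y ≡ true

  -- t triangles and q quadrilaterals, all disjoint, leaving exactly the vertices of L.
  data St : ℕ → ℕ → List V → Set where
    start : ∀ {L} → L ↭ allFin n → St 0 0 L
    tri   : ∀ {t q L} a b c → a ~ b → b ~ c → c ~ a → St t q (a ∷ b ∷ c ∷ L) → St (suc t) q L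
    quad  : ∀ {t q L} a b c d → a ~ b → b ~ c → c ~ d → d ~ a →
            St t q (a ∷ b ∷ c ∷ d ∷ L) → St t (suc q) L

  -- Only `start` records a permutation, so a reordering of the uncovered vertices is carried
  -- inwards to it.
  St-↭ : ∀ {t q L M} → L ↭ M → St t q L → St t q M
  St-↭ p (start s) = start (↭-trans (↭-sym p) s)
  St-↭ p (tri a b c ab bc ca s) = tri a b c ab bc ca (St-↭ (prep a (prep b (prep c p))) s)
  St-↭ p (quad a b c d ab bc cd da s) =
    quad a b c d ab bc cd da (St-↭ (prep a (prep b (prep c (prep d p)))) s)

  -- All vertices, covered or not, come from one permutation of `allFin n`; this is how disjointness
  -- is encoded in a state.
  St-unique : ∀ {t q L} → St t q L → Unique L
  St-unique (start p) = Permₛ.Unique-resp-↭ (≡.setoid V) (↭⇒↭ₛ (↭-sym p)) (allFin⁺ n)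
  St-unique (tri a b c ab bc ca st) with St-unique st
  ... | _ ∷ _ ∷ _ ∷ u = u
  St-unique (quad a b c d ab bc cd da st) with St-unique st
  ... | _ ∷ _ ∷ _ ∷ _ ∷ u = u

  -- The averaging argument as a case distinction: either the edges from `us` leaving `L` amount to
  -- at most `k` per block, or some block receives more and is handed over broken open, its vertices
  -- in front of `L`.
  data Heavy (us : List V) (k : ℕ) (t q : ℕ) (L : List V) : Set where
    light     : total us (allFin n) ≤ total us L + k * (t + q) → Heavy us k t q L
    heavyTri  : ∀ {t′} a b c → suc t′ ≡ t → a ~ b → b ~ c → c ~ a →
               k < total us (a ∷ b ∷ c ∷ []) → St t′ q (a ∷ b ∷ c ∷ L) → Heavy us k t q L
    heavyQuad : ∀ {q′} a b c d → suc q′ ≡ q → a ~ b → b ~ c → c ~ d → d ~ a →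
               k < total us (a ∷ b ∷ c ∷ d ∷ []) → St t q′ (a ∷ b ∷ c ∷ d ∷ L) → Heavy us k t q L

  ++-swap : ∀ (xs ys zs : List V) → xs ++ ys ++ zs ↭ ys ++ xs ++ zs
  ++-swap xs ys zs = ↭-trans (↭-reflexive (sym (++-assoc xs ys zs)))
    (↭-trans (++⁺ʳ zs (++-comm xs ys)) (↭-reflexive (++-assoc ys xs zs)))

  add-block : ∀ us k B L t q → total us (allFin n) ≤ total us (B ++ L) + k * (t + q) →
              total us B ≤ k → total us (allFin n) ≤ total us L + k * suc (t + q)
  add-block us k B L t q h le = ≤-trans h (≤-trans
    (+-monoˡ-≤ _ (≤-trans (≤-reflexive (total-++ us B L)) (+-monoˡ-≤ (total us L) le)))
    (≤-reflexive (regroup k (total us L) (t + q))))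
    where
    regroup : ∀ k l m → (k + l) + k * m ≡ l + k * suc m
    regroup = solve-∀

  -- When the heavy block lies further in, the current block is closed again over the opened state,
  -- which only requires reordering the uncovered vertices.
  heavy-block : ∀ us k {t q L} → St t q L → Heavy us k t q L
  heavy-block us k {L = L} (start p) = light (≤-trans (≤-reflexive (sym (total-↭ us p))) (m≤m+n _ _))
  heavy-block us k {suc t} {q} {L} (tri a b c ab bc ca s) with heavy-block us k s
  ... | heavyTri x y z refl xy yz zx h s′ =
        heavyTri x y z refl xy yz zx h
          (tri a b c ab bc ca (St-↭ (++-swap (x ∷ y ∷ z ∷ []) (a ∷ b ∷ c ∷ []) L) s′))
  ... | heavyQuad x y z w refl xy yz zw wx h s′ =
        heavyQuad x y z w refl xy yz zw wx h
          (tri a b c ab bc ca (St-↭ (++-swap (x ∷ y ∷ z ∷ w ∷ []) (a ∷ b ∷ c ∷ []) L) s′))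
  ... | light h with k <? total us (a ∷ b ∷ c ∷ [])
  ...   | yes lt = heavyTri a b c refl ab bc ca lt s
  ...   | no ≮ = light (add-block us k (a ∷ b ∷ c ∷ []) L t q h (≮⇒≥ ≮))
  heavy-block us k {t} {suc q} {L} (quad a b c d ab bc cd da s) with heavy-block us k s
  ... | heavyTri x y z refl xy yz zx h s′ =
        heavyTri x y z refl xy yz zx h
          (quad a b c d ab bc cd da (St-↭ (++-swap (x ∷ y ∷ z ∷ []) (a ∷ b ∷ c ∷ d ∷ []) L) s′))
  ... | heavyQuad x y z w refl xy yz zw wx h s′ =
        heavyQuad x y z w refl xy yz zw wx h
          (quad a b c d ab bc cd da (St-↭ (++-swap (x ∷ y ∷ z ∷ w ∷ []) (a ∷ b ∷ c ∷ d ∷ []) L) s′))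
  ... | light h with k <? total us (a ∷ b ∷ c ∷ d ∷ [])
  ...   | yes lt = heavyQuad a b c d refl ab bc cd da lt s
  ...   | no ≮ = light (subst (λ m → total us (allFin n) ≤ total us L + k * m) (sym (+-suc t q))
                  (add-block us k (a ∷ b ∷ c ∷ d ∷ []) L t q h (≮⇒≥ ≮)))

-- Shapes, moves and their checks

-- A shape c stands for r ∸ lackT c triangles and s ∸ lackQ c quadrilaterals together with
-- order c uncovered vertices that span at least the edges listed in edges c.
data Shape : Set where
  path₃ fan paw∪path none edge matching cherry claw path₄ triangle paw full : Shape

-- The uncovered vertices are exactly those of the lacking blocks: `order c` is three times
-- `lackT c` plus four times `lackQ c`. Rank 9 marks the two shapes that end the argument.
lackT lackQ order rank : Shape → ℕ
lackT path₃ = 1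
lackT fan = 2
lackT _ = 0
lackQ path₃ = 0
lackQ fan = 0
lackQ full = 0
lackQ paw∪path = 2
lackQ _ = 1
order path₃ = 3
order fan = 6
order paw∪path = 8
order full = 0
order _ = 4
rank path₃ = 0
rank fan = 1
rank paw∪path = 1
rank none = 2
rank edge = 3
rank matching = 4
rank cherry = 5
rank claw = 6
rank path₄ = 7
rank triangle = 8
rank paw = 9
rank full = 9

edges : Shape → List (ℕ × ℕ)
edges path₃ = (0 , 1) ∷ (1 , 2) ∷ []
-- The last five pairs are five of the six edges between the ends of the path and the triangle: one
-- non-adjacent pair makes a heavy triangle receive more than four.
edges fan = (0 , 1) ∷ (1 , 2) ∷ (3 , 4) ∷ (4 , 5) ∷ (5 , 3) ∷
            (0 , 3) ∷ (0 , 4) ∷ (0 , 5) ∷ (2 , 3) ∷ (2 , 4) ∷ []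
edges paw∪path = (0 , 1) ∷ (1 , 2) ∷ (2 , 0) ∷ (0 , 3) ∷ (4 , 5) ∷ (5 , 6) ∷ (6 , 7) ∷ []
edges none = []
edges edge = (0 , 1) ∷ []
edges matching = (0 , 1) ∷ (2 , 3) ∷ []
edges cherry = (0 , 1) ∷ (1 , 2) ∷ []
edges claw = (0 , 1) ∷ (0 , 2) ∷ (0 , 3) ∷ []
edges path₄ = (0 , 1) ∷ (1 , 2) ∷ (2 , 3) ∷ []
edges triangle = (0 , 1) ∷ (1 , 2) ∷ (2 , 0) ∷ []
edges paw = (0 , 1) ∷ (1 , 2) ∷ (2 , 0) ∷ (0 , 3) ∷ []
edges full = []

triEdges quadEdges : ℕ → List (ℕ × ℕ)
triEdges o = (o , 1 + o) ∷ (1 + o , 2 + o) ∷ (2 + o , o) ∷ []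
quadEdges o = (o , 1 + o) ∷ (1 + o , 2 + o) ∷ (2 + o , 3 + o) ∷ (3 + o , o) ∷ []

shiftEdges : ℕ → List (ℕ × ℕ) → List (ℕ × ℕ)
shiftEdges o = map λ e → o + proj₁ e , o + proj₂ e

layout : ℕ → ℕ → ℕ → List (ℕ × ℕ) → List (ℕ × ℕ)
layout zero zero o es = shiftEdges o es
layout zero (suc b) o es = quadEdges o ++ layout zero b (4 + o) es
layout (suc a) b o es = triEdges o ++ layout a b (3 + o) es

extent : ℕ → ℕ → ℕ → ℕ
extent zero zero m = m
extent zero (suc b) m = 4 + extent zero b m
extent (suc a) b m = 3 + extent a b m

digits : ℕ → ℕ → List ℕ → List ℕ
digits zero x acc = acc
digits (suc k) x acc = digits k (x / 16) (x % 16 ∷ acc)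

-- A rearrangement of the vertices 0, …, k ∸ 1 is written as a hexadecimal numeral with k
-- digits, in the order: new triangles, new quadrilaterals, vertices of the shape. The
-- vertices of a block that has been broken up come first.
Move : Set
Move = Shape × ℕ

relabel : List ℕ → List (ℕ × ℕ) → List (ℕ × ℕ)
relabel π = map λ e → nth π (proj₁ e) , nth π (proj₂ e)

-- `dt` and `dq` count the triangles and quadrilaterals lacking before the move, a broken block
-- included. The new shape may lack some of them; the move has to create the others.
demand : (dt dq k : ℕ) → Move → List (ℕ × ℕ)
demand dt dq k (c , x) = relabel (digits k x []) (layout (dt ∸ lackT c) (dq ∸ lackQ c) 0 (edges c))

-- The equations after the rank test rule out truncated subtraction and a wrong number of vertices;
-- `perm?` ensures that each vertex is used exactly once.
fits : (dt dq k ρ : ℕ) → Move → Bool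
fits dt dq k ρ (c , x) =
  (ρ <ᵇ rank c) ∧ ((dt ∸ lackT c + lackT c ≡ᵇ dt) ∧ ((dq ∸ lackQ c + lackQ c ≡ᵇ dq) ∧
  ((extent (dt ∸ lackT c) (dq ∸ lackQ c) (order c) ≡ᵇ k) ∧
  (perm? (range 0 k) (digits k x []) ∧ every faithful (demand dt dq k (c , x))))))

missing : List ℕ → List ℕ → List ℕ
missing kn [] = []
missing kn (e ∷ es) = if elem e kn then missing kn es else e ∷ missing kn es

moves : List (Shape × List ℕ) → List Move
moves = concatMap λ m → map (proj₁ m ,_) (proj₂ m)

needs : (dt dq k : ℕ) → List (ℕ × ℕ) → Move → List ℕ
needs dt dq k kn m = missing (codes kn) (codes (demand dt dq k m))

-- At least `thr` edges between `us` and `js` leave at most `length ∸ thr` absent pairs, which is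
-- the budget. Edges in `kn` are struck from the patterns, those in `kf` are charged in advance.
checkMoves : (dt dq k ρ : ℕ) (kn kf : List (ℕ × ℕ)) (us js : List ℕ) (thr : ℕ) → List Move → Bool
checkMoves dt dq k ρ kn kf us js thr ms =
  every (fits dt dq k ρ) ms ∧ (every faithful kn ∧ (every faithful kf ∧ (every faithful (pairings us js) ∧
  searchGiven (codes kf) (codes (pairings us js)) (length (codes (pairings us js)) ∸ thr)
    (map (needs dt dq k kn) ms))))

-- How to improve a shape: query adjacencies (ask) until either the shape can be replaced at
-- once (up), or enough non-adjacent pairs are known to apply the degree condition to (use).
data Plan : Set where
  ask : ℕ × ℕ → Plan → Plan → Plan
  up  : Shape → ℕ → Plan
  use : List (ℕ × ℕ) → List (Shape × List ℕ) → Plan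

-- `weights` lists the ends of the chosen non-adjacent pairs. It is common to all `use` leaves of
-- the plan, so the checks on a heavy block are made once per shape.
record Table : Set where
  field
    weights : List ℕ
    onTri onQuad : List (Shape × List ℕ)
    plan : Plan

ends : List (ℕ × ℕ) → List ℕ
ends = concatMap λ e → proj₁ e ∷ proj₂ e ∷ []

apart : ℕ → List (ℕ × ℕ) → ℕ × ℕ → Bool
apart k kf (i , j) = (i <ᵇ k) ∧ ((j <ᵇ k) ∧ (not (i ≡ᵇ j) ∧ (faithful (i , j) ∧ elem (code i j) (codes kf))))

isNil : List ℕ → Bool
isNil [] = true
isNil (_ ∷ _) = false

module _ (c : Shape) (tab : Table) where
  open Table tab

  checkPlan : (kn kf : List (ℕ × ℕ)) → Plan → Bool
  checkPlan kn kf (ask e p q) = checkPlan (e ∷ kn) kf p ∧ checkPlan kn (e ∷ kf) q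
  checkPlan kn kf (up c′ x) =
    fits (lackT c) (lackQ c) (order c) (rank c) (c′ , x) ∧
    (every faithful kn ∧ isNil (needs (lackT c) (lackQ c) (order c) kn (c′ , x)))
  checkPlan kn kf (use ps ms) =
    perm? (ends ps) weights ∧ (every (apart (order c) kf) ps ∧ (every faithful kf ∧
    ((length ps * 4 ≡ᵇ length weights * 2) ∧
    checkMoves (lackT c) (lackQ c) (order c) (rank c) kn kf weights (range 0 (order c))
      (length weights * 2 * (lackT c + lackQ c)) (moves ms))))

  -- The broken block takes the first labels and the shape is shifted behind it. With two ends per
  -- pair, twice the length of `weights` is four per pair; the successor expresses that the block
  -- receives more.
  checkTri checkQuad : Bool
  checkTri = checkMoves (1 + lackT c) (lackQ c) (3 + order c) (rank c)
    (triEdges 0 ++ shiftEdges 3 (edges c)) [] (map (3 +_) weights) (range 0 3)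
    (suc (length weights * 2)) (moves onTri)
  checkQuad = checkMoves (lackT c) (1 + lackQ c) (4 + order c) (rank c)
    (quadEdges 0 ++ shiftEdges 4 (edges c)) [] (map (4 +_) weights) (range 0 4)
    (suc (length weights * 2)) (moves onQuad)

-- Soundness of moves and plans in a graph with the degree condition

module Engine {n : ℕ} (A : Fin n → Fin n → Bool) (A-sym : ∀ x y → A x y ≡ A y x)
  (r s : ℕ)
  (ore : ∀ x y → x ≢ y → A x y ≡ false →
         4 * (r + s) ≤ Packings.hits A x (allFin n) + Packings.hits A y (allFin n))
  where

  open Packings A

  Linked Unlinked : (ℕ → V) → ℕ × ℕ → Set
  Linked v e = v (proj₁ e) ~ v (proj₂ e)
  Unlinked v e = A (v (proj₁ e)) (v (proj₂ e)) ≡ false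

  -- Vertices are named by a function on `ℕ`, so that relabelling is composition; only its values
  -- below `order c` are constrained.
  record Has (c : Shape) : Set where
    constructor has
    field
      {t q} : ℕ
      t-eq : t + lackT c ≡ r
      q-eq : q + lackQ c ≡ s
      v    : ℕ → V
      st   : St t q (map v (range 0 (order c)))
      links : All (Linked v) (edges c)

  Better : ℕ → Set
  Better ρ = ∃ λ c → ρ < rank c × Has c

  at : (ℕ → V) → ℕ → Bool
  at v x = A (v (x / 16)) (v (x % 16))

  faithful-sound : ∀ v i j → faithful (i , j) ≡ true → at v (code i j) ≡ A (v i) (v j)
  faithful-sound v i j eq with encodes (code i j) i j in enc
  ... | true = let p , q = ∧-true ((code i j / 16) ≡ᵇ i) enc in
        cong₂ (λ k l → A (v k) (v l)) (≡ᵇ-true (code i j / 16) i p) (≡ᵇ-true (code i j % 16) j q)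
  ... | false = let p , q = ∧-true ((code i j / 16) ≡ᵇ j) eq in ≡.trans
        (cong₂ (λ k l → A (v k) (v l)) (≡ᵇ-true (code i j / 16) j p) (≡ᵇ-true (code i j % 16) i q))
        (A-sym (v j) (v i))

  module _ (v : ℕ → V) where

    coded : ∀ b es → every faithful es ≡ true → All (λ e → A (v (proj₁ e)) (v (proj₂ e)) ≡ b) es →
            All (λ x → at v x ≡ b) (codes es)
    coded b [] eq [] = []
    coded b ((i , j) ∷ es) eq (h ∷ hs) = let p , q = ∧-true (faithful (i , j)) eq in
      ≡.trans (faithful-sound v i j p) h ∷ coded b es q hs

    uncoded : ∀ b es → every faithful es ≡ true → All (λ x → at v x ≡ b) (codes es) →
              All (λ e → A (v (proj₁ e)) (v (proj₂ e)) ≡ b) es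
    uncoded b [] eq [] = []
    uncoded b ((i , j) ∷ es) eq (h ∷ hs) = let p , q = ∧-true (faithful (i , j)) eq in
      ≡.trans (sym (faithful-sound v i j p)) h ∷ uncoded b es q hs

    elem-sound : ∀ {b} e xs → elem e xs ≡ true → All (λ x → at v x ≡ b) xs → at v e ≡ b
    elem-sound e (x ∷ xs) eq (h ∷ hs) with e ≡ᵇ x in ex
    ... | true rewrite ≡ᵇ-true e x ex = h
    ... | false = elem-sound e xs eq hs

    missing-sound : ∀ kn xs → Present (at v) kn → Present (at v) (missing kn xs) → Present (at v) xs
    missing-sound kn [] hk [] = []
    missing-sound kn (x ∷ xs) hk h with elem x kn in ex
    missing-sound kn (x ∷ xs) hk h | true = elem-sound x kn ex hk ∷ missing-sound kn xs hk h
    missing-sound kn (x ∷ xs) hk (p ∷ h) | false = p ∷ missing-sound kn xs hk h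

    loss-row : ∀ u js ws → every faithful (map (u ,_) js ++ ws) ≡ true →
      loss (at v) (codes (map (u ,_) js ++ ws)) + hits (v u) (map v js) ≡
      length js + loss (at v) (codes ws)
    loss-row u [] ws eq = +-identityʳ _
    loss-row u (j ∷ js) ws eq with ∧-true (faithful (u , j)) eq
    ... | p , q rewrite faithful-sound v u j p with A (v u) (v j)
    ...   | true = ≡.trans (+-suc _ _) (cong suc (loss-row u js ws q))
    ...   | false = cong suc (loss-row u js ws q)

    -- Every weighted pair is an edge or absent. This turns a lower bound on edges into the upper
    -- bound on absences that the search expects.
    loss-total : ∀ us js → every faithful (pairings us js) ≡ true →
      loss (at v) (codes (pairings us js)) + total (map v us) (map v js) ≡ length (codes (pairings us js))
    loss-total [] js eq = refl
    loss-total (u ∷ us) js eq = begin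
      l + (h + τ)             ≡⟨ +-assoc l h τ ⟨
      l + h + τ               ≡⟨ cong (_+ τ) (loss-row u js (pairings us js) eq) ⟩
      length js + l′ + τ      ≡⟨ +-assoc (length js) l′ τ ⟩
      length js + (l′ + τ)    ≡⟨ cong (length js +_) (loss-total us js (every-++ʳ faithful (map (u ,_) js) eq)) ⟩
      length js + length (codes (pairings us js))
        ≡⟨ cong (_+ length (codes (pairings us js))) (≡.trans (length-map _ js′) (length-map _ js)) ⟨
      length (codes js′) + length (codes (pairings us js)) ≡⟨ length-++ (codes js′) ⟨
      length (codes js′ ++ codes (pairings us js)) ≡⟨ cong length (map-++ _ js′ (pairings us js)) ⟨
      length (codes (pairings (u ∷ us) js)) ∎
      where
      open ≡.≡-Reasoning
      js′ = map (u ,_) js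
      l = loss (at v) (codes (pairings (u ∷ us) js))
      l′ = loss (at v) (codes (pairings us js))
      h = hits (v u) (map v js)
      τ = total (map v us) (map v js)

  -- Follows the order of `layout`: the vertices at the front are closed into triangles, then
  -- quadrilaterals, until only those of the shape remain.
  rebuild : ∀ a b o {m es t q dt dq} v → t + (a + dt) ≡ r → q + (b + dq) ≡ s →
    St t q (map v (range o (extent a b m))) → All (Linked v) (layout a b o es) →
    ∃ λ t′ → ∃ λ q′ → ∃ λ o′ → t′ + dt ≡ r × q′ + dq ≡ s ×
      St t′ q′ (map v (range o′ m)) × All (Linked v) (shiftEdges o′ es)
  rebuild zero zero o v te qe st ls = _ , _ , o , te , qe , st , ls
  rebuild zero (suc b) o {q = q} {dq = dq} v te qe st (ab ∷ bc ∷ cd ∷ da ∷ ls) =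
    rebuild zero b (4 + o) v te (≡.trans (sym (+-suc q (b + dq))) qe) (quad _ _ _ _ ab bc cd da st) ls
  rebuild (suc a) b o {t = t} {dt = dt} v te qe st (ab ∷ bc ∷ ca ∷ ls) =
    rebuild a b (3 + o) v (≡.trans (sym (+-suc t (a + dt))) te) qe (tri _ _ _ ab bc ca st) ls

  unshift : ∀ v o es → All (Linked v) (shiftEdges o es) → All (Linked (v ∘ (o +_))) es
  unshift v o [] [] = []
  unshift v o (e ∷ es) (l ∷ ls) = l ∷ unshift v o es ls

  unrelabel : ∀ v π es → All (Linked v) (relabel π es) → All (Linked (v ∘ nth π)) es
  unrelabel v π [] [] = []
  unrelabel v π (e ∷ es) (l ∷ ls) = l ∷ unrelabel v π es ls

  length-range : ∀ o k → length (range o k) ≡ k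
  length-range o zero = refl
  length-range o (suc k) = cong suc (length-range (suc o) k)

  map-relabel : ∀ (v : ℕ → V) k π → range 0 k ↭ π → map v (range 0 k) ↭ map (v ∘ nth π) (range 0 k)
  map-relabel v k π p = ↭-trans (map⁺ v p) (↭-reflexive (≡.trans (sym (map-nth v π))
    (cong (λ l → map (v ∘ nth π) (range 0 l)) (≡.trans (sym (↭-length p)) (length-range 0 k)))))

  move : ∀ {dt dq k ρ t q} v m → fits dt dq k ρ m ≡ true → t + dt ≡ r → q + dq ≡ s →
    St t q (map v (range 0 k)) → All (Linked v) (demand dt dq k m) → Better ρ
  move {dt} {dq} {k} {ρ} {t} {q} v (c , x) ok te qe st ls
    with ∧-true (ρ <ᵇ rank c) ok
  ... | better , ok₁ with ∧-true (dt ∸ lackT c + lackT c ≡ᵇ dt) ok₁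
  ... | tri-fit , ok₂ with ∧-true (dq ∸ lackQ c + lackQ c ≡ᵇ dq) ok₂
  ... | quad-fit , ok₃ with ∧-true (extent (dt ∸ lackT c) (dq ∸ lackQ c) (order c) ≡ᵇ k) ok₃
  ... | size-fit , ok₄ with ∧-true (perm? (range 0 k) (digits k x [])) ok₄
  ... | is-perm , _ = finish (rebuild (dt ∸ lackT c) (dq ∸ lackQ c) 0 {order c} {edges c} w
      (≡.trans (cong (t +_) (≡ᵇ-true _ dt tri-fit)) te) (≡.trans (cong (q +_) (≡ᵇ-true _ dq quad-fit)) qe)
      (subst (λ l → St t q (map w (range 0 l))) (sym (≡ᵇ-true _ k size-fit))
        (St-↭ (map-relabel v k π (perm-sound _ _ is-perm)) st))
      (unrelabel v π _ ls))
    where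
    π = digits k x []
    w = v ∘ nth π
    finish : (∃ λ t′ → ∃ λ q′ → ∃ λ o → t′ + lackT c ≡ r × q′ + lackQ c ≡ s ×
      St t′ q′ (map w (range o (order c))) × All (Linked w) (shiftEdges o (edges c))) → Better ρ
    finish (t′ , q′ , o , te′ , qe′ , st′ , ls′) = c , <ᵇ-true ρ (rank c) better ,
      has te′ qe′ (w ∘ (o +_))
        (subst (St t′ q′) (≡.trans (cong (λ i → map w (range i (order c))) (sym (+-identityʳ o)))
                                   (map-range w o 0 (order c))) st′)
        (unshift w o (edges c) ls′)

  demand-sound : ∀ {dt dq k ρ} v kn m → fits dt dq k ρ m ≡ true → every faithful kn ≡ true →
    All (Linked v) kn → Present (at v) (needs dt dq k kn m) → All (Linked v) (demand dt dq k m)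
  demand-sound {dt} {dq} {k} {ρ} v kn (c , x) ok fk lk pr = uncoded v true _ faith
    (missing-sound v (codes kn) _ (coded v true kn fk lk) pr)
    where
    faith : every faithful (demand dt dq k (c , x)) ≡ true
    faith = proj₂ (∧-true (perm? (range 0 k) (digits k x []))
      (proj₂ (∧-true (extent (dt ∸ lackT c) (dq ∸ lackQ c) (order c) ≡ᵇ k)
      (proj₂ (∧-true (dq ∸ lackQ c + lackQ c ≡ᵇ dq) (proj₂ (∧-true (dt ∸ lackT c + lackT c ≡ᵇ dt)
      (proj₂ (∧-true (ρ <ᵇ rank c) ok)))))))))

  -- The edge count bounds the loss, the search then yields a move whose missing edges are all
  -- present, and `move` carries it out.
  moves-sound : ∀ {dt dq k ρ t q} v kn kf us js thr ms →
    checkMoves dt dq k ρ kn kf us js thr ms ≡ true →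
    t + dt ≡ r → q + dq ≡ s → St t q (map v (range 0 k)) →
    All (Linked v) kn → All (Unlinked v) kf → thr ≤ total (map v us) (map v js) → Better ρ
  moves-sound {dt} {dq} {k} {ρ} v kn kf us js thr ms ok te qe st lk lf le
    with ∧-true (every (fits dt dq k ρ) ms) ok
  ... | all-fit , ok₁ with ∧-true (every faithful kn) ok₁
  ... | faith-kn , ok₂ with ∧-true (every faithful kf) ok₂
  ... | faith-kf , ok₃ with ∧-true (every faithful (pairings us js)) ok₃
  ... | faith , found = choose ms (every-sound _ ms all-fit) (Any.map⁻
        (searchGiven-sound (at v) (codes kf) ws _ _ (coded v false kf faith-kf lf) found small))
    where
    ws = codes (pairings us js)
    small : loss (at v) ws ≤ length ws ∸ thr
    small = subst (_≤ length ws ∸ thr)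
      (≡.trans (cong (_∸ total (map v us) (map v js)) (sym (loss-total v us js faith)))
               (m+n∸n≡m (loss (at v) ws) (total (map v us) (map v js))))
      (∸-monoʳ-≤ (length ws) le)
    choose : ∀ ms → All (λ m → fits dt dq k ρ m ≡ true) ms →
             Any (Present (at v) ∘ needs dt dq k kn) ms → Better ρ
    choose (m ∷ ms) (f ∷ _) (here p) = move v m f te qe st (demand-sound v kn m f faith-kn lk p)
    choose (m ∷ ms) (_ ∷ fs) (there p) = choose ms fs p

  ∈-range : ∀ (v : ℕ → V) o k j → j < k → v (o + j) ∈ map v (range o k)
  ∈-range v o (suc k) zero _ rewrite +-identityʳ o = here refl
  ∈-range v o (suc k) (suc j) (s≤s lt) rewrite +-suc o j = there (∈-range v (suc o) k j lt)

  range-distinct : ∀ (v : ℕ → V) o k i j → Unique (map v (range o k)) → i < k → j < k →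
    i ≢ j → v (o + i) ≢ v (o + j)
  range-distinct v o (suc k) zero zero _ _ _ i≢j = contradiction refl i≢j
  range-distinct v o (suc k) zero (suc j) (u ∷ us) _ (s≤s j<k) _ eq
    rewrite +-identityʳ o | +-suc o j = All.lookup u (∈-range v (suc o) k j j<k) eq
  range-distinct v o (suc k) (suc i) zero (u ∷ us) (s≤s i<k) _ _ eq
    rewrite +-identityʳ o | +-suc o i = All.lookup u (∈-range v (suc o) k i i<k) (sym eq)
  range-distinct v o (suc k) (suc i) (suc j) (_ ∷ us) (s≤s i<k) (s≤s j<k) i≢j eq
    rewrite +-suc o i | +-suc o j =
    range-distinct v (suc o) k i j us i<k j<k (i≢j ∘ cong suc) eq

  -- Each pair gives one instance of the degree condition: its ends differ because uncovered
  -- vertices are distinct, and they are non-adjacent because the pair is among the known absences.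
  pairs-heavy : ∀ v k kf ps → Unique (map v (range 0 k)) → every faithful kf ≡ true →
    All (Unlinked v) kf → every (apart k kf) ps ≡ true →
    length ps * (4 * (r + s)) ≤ total (map v (ends ps)) (allFin n)
  pairs-heavy v k kf [] un fk lf ok = z≤n
  pairs-heavy v k kf ((i , j) ∷ ps) un fk lf ok with ∧-true (apart k kf (i , j)) ok
  ... | ok₀ , rest-ok with ∧-true (i <ᵇ k) ok₀
  ... | i<k , ok₁ with ∧-true (j <ᵇ k) ok₁
  ... | j<k , ok₂ with ∧-true (not (i ≡ᵇ j)) ok₂
  ... | i≢j , ok₃ with ∧-true (faithful (i , j)) ok₃
  ... | faith , known = ≤-trans
        (+-mono-≤ (ore (v i) (v j)
            (range-distinct v 0 k i j un (<ᵇ-true i k i<k) (<ᵇ-true j k j<k) distinct)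
            (≡.trans (sym (faithful-sound v i j faith)) (elem-sound v _ _ known (coded v false kf fk lf))))
          (pairs-heavy v k kf ps un fk lf rest-ok))
        (≤-reflexive (+-assoc (hits (v i) (allFin n)) _ _))
    where
    distinct : i ≢ j
    distinct eq = contradiction
      (≡.trans (sym i≢j) (cong not (≡.trans (cong (i ≡ᵇ_) (sym eq)) (≡ᵇ-refl i)))) λ ()
      where
      ≡ᵇ-refl : ∀ i → (i ≡ᵇ i) ≡ true
      ≡ᵇ-refl zero = refl
      ≡ᵇ-refl (suc i) = ≡ᵇ-refl i

  _◂_ : V → (ℕ → V) → ℕ → V
  (a ◂ v) zero = a
  (a ◂ v) (suc i) = v i

  ◂-range : ∀ a v k → map (a ◂ v) (range 0 (suc k)) ≡ a ∷ map v (range 0 k)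
  ◂-range a v k = cong (a ∷_) (map-range (a ◂ v) 1 0 k)

  Linked-shift : ∀ o (w v : ℕ → V) es → (∀ i → w (o + i) ≡ v i) → All (Linked v) es →
    All (Linked w) (shiftEdges o es)
  Linked-shift o w v [] eq [] = []
  Linked-shift o w v ((i , j) ∷ es) eq (l ∷ ls) =
    ≡.trans (cong₂ A (eq i) (eq j)) l ∷ Linked-shift o w v es eq ls

  map-shift : ∀ o (w v : ℕ → V) us → (∀ i → w (o + i) ≡ v i) → map w (map (o +_) us) ≡ map v us
  map-shift o w v us eq = ≡.trans (sym (map-∘ us)) (map-cong eq us)

  module _ (c : Shape) (tab : Table)
    (tri-ok : checkTri c tab ≡ true) (quad-ok : checkQuad c tab ≡ true)
    {t q : ℕ} (te : t + lackT c ≡ r) (qe : q + lackQ c ≡ s)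
    (v : ℕ → V) (st : St t q (map v (range 0 (order c)))) (links : All (Linked v) (edges c)) where

    open Table tab

    us : List V
    us = map v weights

    follow : ∀ kn kf plan → checkPlan c tab kn kf plan ≡ true →
      All (Linked v) kn → All (Unlinked v) kf → Better (rank c)
    follow kn kf (ask e p p′) ok lk lf with A (v (proj₁ e)) (v (proj₂ e)) in ae
    ... | true = follow (e ∷ kn) kf p (proj₁ (∧-true (checkPlan c tab (e ∷ kn) kf p) ok)) (ae ∷ lk) lf
    ... | false = follow kn (e ∷ kf) p′ (proj₂ (∧-true (checkPlan c tab (e ∷ kn) kf p) ok)) lk (ae ∷ lf)
    follow kn kf (up c′ x) ok lk lf
      with ∧-true (fits (lackT c) (lackQ c) (order c) (rank c) (c′ , x)) ok
    ... | fit , ok₁ with ∧-true (every faithful kn) ok₁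
    ... | faith , nil = move v (c′ , x) fit te qe st
          (demand-sound v kn (c′ , x) fit faith lk (present
            (needs (lackT c) (lackQ c) (order c) kn (c′ , x)) nil))
      where
      present : ∀ xs → isNil xs ≡ true → Present (at v) xs
      present [] _ = []
    follow kn kf (use ps ms) ok lk lf with ∧-true (perm? (ends ps) weights) ok
    ... | is-perm , ok₁ with ∧-true (every (apart (order c) kf) ps) ok₁
    ... | aparts , ok₂ with ∧-true (every faithful kf) ok₂
    ... | faith , ok₃ with ∧-true (length ps * 4 ≡ᵇ length weights * 2) ok₃
    -- For c pairs the threshold is 4c per block, matching the 4c(r + s) that the pairs guarantee.
    ... | sizes , ok₄ with heavy-block us (length weights * 2) st
    ... | heavyTri x y z refl xy yz zx heavy st′ =
          moves-sound w (triEdges 0 ++ shiftEdges 3 (edges c)) [] (map (3 +_) weights) (range 0 3) _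
            (moves onTri) tri-ok
            (≡.trans (+-suc _ (lackT c)) te) qe
            (subst (St _ _) (sym (≡.trans (◂-range x _ _) (cong (x ∷_)
              (≡.trans (◂-range y _ _) (cong (y ∷_) (◂-range z v _)))))) st′)
            (xy ∷ yz ∷ zx ∷ Linked-shift 3 w v (edges c) (λ _ → refl) links) []
            (subst (λ l → _ < total l (x ∷ y ∷ z ∷ [])) (sym (map-shift 3 w v weights λ _ → refl)) heavy)
      where w = x ◂ (y ◂ (z ◂ v))
    ... | heavyQuad x y z u refl xy yz zu ux heavy st′ =
          moves-sound w (quadEdges 0 ++ shiftEdges 4 (edges c)) [] (map (4 +_) weights) (range 0 4) _
            (moves onQuad) quad-ok
            te (≡.trans (+-suc _ (lackQ c)) qe)
            (subst (St _ _) (sym (≡.trans (◂-range x _ _) (cong (x ∷_) (≡.trans (◂-range y _ _) (cong (y ∷_)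
              (≡.trans (◂-range z _ _) (cong (z ∷_) (◂-range u v _)))))))) st′)
            (xy ∷ yz ∷ zu ∷ ux ∷ Linked-shift 4 w v (edges c) (λ _ → refl) links) []
            (subst (λ l → _ < total l (x ∷ y ∷ z ∷ u ∷ [])) (sym (map-shift 4 w v weights λ _ → refl)) heavy)
      where w = x ◂ (y ◂ (z ◂ (u ◂ v)))
    -- The blocks absorb at most 4c each, so the share of the lacking blocks falls on edges inside
    -- the shape.
    ... | light h = moves-sound v kn kf weights (range 0 (order c)) _ (moves ms) ok₄ te qe st lk lf own
      where
      k = length weights * 2
      lower : k * (r + s) ≤ total us (allFin n)
      lower = ≤-trans (≤-reflexive (≡.trans (cong (_* (r + s)) (sym (≡ᵇ-true (length ps * 4) k sizes)))
                                            (*-assoc (length ps) 4 (r + s))))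
        (≤-trans (pairs-heavy v (order c) kf ps (St-unique st) faith lf aparts)
          (≤-reflexive (total-↭ˡ (allFin n) (map⁺ v (perm-sound (ends ps) weights is-perm)))))
      split : ∀ k t dt q dq → k * ((t + dt) + (q + dq)) ≡ k * (dt + dq) + k * (t + q)
      split = solve-∀
      own : k * (lackT c + lackQ c) ≤ total us (map v (range 0 (order c)))
      own = +-cancelʳ-≤ (k * (t + q)) _ _ (≤-trans
        (≤-reflexive (≡.trans (sym (split k t (lackT c) q (lackQ c))) (cong (k *_) (cong₂ _+_ te qe))))
        (≤-trans lower h))

-- Tables of moves

-- The moves below were found by computer search.
pawPathOwn : List (Shape × List ℕ)
pawPathOwn =
  (none , 0x02134567 ∷ 0x01234567 ∷ 0x45670123 ∷ 0x01542367 ∷ 0x02541367 ∷ 0x01652347 ∷ 0x03651247 ∷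
    0x03561247 ∷ 0x01273456 ∷ 0x01432567 ∷ 0x01523467 ∷ 0x01632457 ∷ 0x01732456 ∷ 0x24560137 ∷
    0x45760123 ∷ []) ∷ []

table : Shape → Table
table path₃ = record
  { weights = 0 ∷ 2 ∷ []
  ; onTri = (fan , 0x345012 ∷ 0x543012 ∷ 0x345021 ∷ 0x543021 ∷ 0x345120 ∷ 0x543120 ∷ []) ∷ []
  ; onQuad = (matching , 0x0341256 ∷ 0x0361245 ∷ 0x1240356 ∷ 0x1260345 ∷ []) ∷ []
  -- An empty list of moves after `use` means that the known absences already exceed the budget, so
  -- the uncovered vertices cannot carry the required edges.
  ; plan = ask (0 , 2) (up full 0x012) (use ((0 , 2) ∷ []) [])
  }
table fan = record
  -- The pair of 1 and 5 is used twice. Vertex 5 is the one triangle vertex whose edge to the path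
  -- end 2 is not given.
  { weights = 0 ∷ 2 ∷ 1 ∷ 5 ∷ 1 ∷ 5 ∷ []
  ; onTri = (full , 0x034128567 ∷ 0x038124567 ∷ 0x013245678 ∷ 0x023145678 ∷ 0x045128367 ∷ 0x024138567 ∷
      0x014238567 ∷ 0x025134678 ∷ 0x015234678 ∷ 0x028134567 ∷ 0x028145367 ∷ 0x018245367 ∷ []) ∷ []
  ; onQuad = (matching , 0x0347891256 ∷ 0x0354791268 ∷ 0x0167892345 ∷ 0x0194782356 ∷ 0x1247890356 ∷ 0x1254790368 ∷
      0x2367890145 ∷ 0x2394780156 ∷ []) ∷ []
  ; plan = ask (0 , 2) (up full 0x012345) (ask (1 , 5) (up full 0x105234)
    (use ((0 , 2) ∷ (1 , 5) ∷ (1 , 5) ∷ []) ((full , 0x035124 ∷ []) ∷ [])))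
  }
table paw∪path = record
  -- The leaves of the plan use different pairs, but always four disjoint ones covering the eight
  -- vertices.
  { weights = 0 ∷ 1 ∷ 2 ∷ 3 ∷ 4 ∷ 5 ∷ 6 ∷ 7 ∷ []
  ; onTri = (none , 0x3450216789a ∷ 0x3450126789a ∷ 0x3450789126a ∷ 0x3450278169a ∷ 0x345019a2678 ∷
      0x345012a6789 ∷ 0x3450162789a ∷ 0x3450182679a ∷ 0x34512a90678 ∷ 0x345129a0678 ∷ []) ∷ []
  ; onQuad = (none , 0x4327081b569a ∷ 0x4307182b569a ∷ 0x4365172b89a0 ∷ 0x436517289ab0 ∷ 0x4365071b89a2 ∷
      0x436507189ab2 ∷ 0x4356172b89a0 ∷ 0x435617289ab0 ∷ 0x4356071b89a2 ∷ 0x435607189ab2 ∷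
      0x4237081b569a ∷ 0x4217083b569a ∷ 0x4265073b89a1 ∷ 0x426507389ab1 ∷ 0x4265071b89a3 ∷
      0x426507189ab3 ∷ 0x4256073b89a1 ∷ 0x425607389ab1 ∷ 0x4256071b89a3 ∷ 0x425607189ab3 ∷
      0x4127083b569a ∷ 0x4107283b569a ∷ 0x4165273b89a0 ∷ 0x416527389ab0 ∷ 0x4165073b89a2 ∷
      0x416507389ab2 ∷ 0x4156273b89a0 ∷ 0x415627389ab0 ∷ 0x4156073b89a2 ∷ 0x415607389ab2 ∷
      0x4037182b569a ∷ 0x4017283b569a ∷ 0x4065273b89a1 ∷ 0x406527389ab1 ∷ 0x4065172b89a3 ∷
      0x406517289ab3 ∷ 0x4056273b89a1 ∷ 0x405627389ab1 ∷ 0x4056172b89a3 ∷ 0x405617289ab3 ∷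
      0x8329a10b4567 ∷ 0x8309a12b4567 ∷ 0x8239a01b4567 ∷ 0x8219a03b4567 ∷ 0x8129a30b4567 ∷
      0x8109a32b4567 ∷ 0x8039a21b4567 ∷ 0x8019a23b4567 ∷ 0x463792ba5801 ∷ 0x463791ba5802 ∷
      0x463790ba5812 ∷ 0x463782a95b01 ∷ 0x463781a95b02 ∷ 0x463780a95b12 ∷ 0x462793ba5801 ∷
      0x462791ba5803 ∷ 0x462790ba5813 ∷ 0x462783a95b01 ∷ 0x462781a95b03 ∷ 0x462780a95b13 ∷
      0x461793ba5802 ∷ 0x461792ba5803 ∷ 0x461790ba5823 ∷ 0x461783a95b02 ∷ 0x461782a95b03 ∷
      0x461780a95b23 ∷ 0x460793ba5812 ∷ 0x460792ba5813 ∷ 0x460791ba5823 ∷ 0x460783a95b12 ∷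
      0x460782a95b13 ∷ 0x460781a95b23 ∷ 0x453792ba6801 ∷ 0x453791ba6802 ∷ 0x453790ba6812 ∷
      0x453782a96b01 ∷ 0x453781a96b02 ∷ 0x453780a96b12 ∷ 0x4537601289ab ∷ 0x4536b012789a ∷
      0x4536a12b7890 ∷ 0x4536a10b7892 ∷ 0x4536a012789b ∷ 0x4536901278ab ∷ 0x453682197ab0 ∷
      0x453680197ab2 ∷ 0x4536801279ab ∷ 0x4536701289ab ∷ 0x5326a10b4789 ∷ 0x5326a01b4789 ∷
      0x5326810947ab ∷ 0x5326801947ab ∷ 0x5306a21b4789 ∷ 0x5306a12b4789 ∷ 0x5306821947ab ∷
      0x5306812947ab ∷ 0x452793ba6801 ∷ 0x452791ba6803 ∷ 0x452790ba6813 ∷ 0x452783a96b01 ∷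
      0x452781a96b03 ∷ 0x452780a96b13 ∷ 0x4527610389ab ∷ 0x5236a10b4789 ∷ 0x5236a01b4789 ∷
      0x5236810947ab ∷ 0x5236801947ab ∷ 0x4526b103789a ∷ 0x4526a103789b ∷ 0x4526a03b7891 ∷
      0x4526a01b7893 ∷ 0x4526910378ab ∷ 0x452683097ab1 ∷ 0x452681097ab3 ∷ 0x4526810379ab ∷
      0x4526710389ab ∷ 0x5216a30b4789 ∷ 0x5216a03b4789 ∷ 0x5216830947ab ∷ 0x5216803947ab ∷
      0x451793ba6802 ∷ 0x451792ba6803 ∷ 0x451790ba6823 ∷ 0x451783a96b02 ∷ 0x451782a96b03 ∷
      0x451780a96b23 ∷ 0x4517603289ab ∷ 0x5126a30b4789 ∷ 0x5126a03b4789 ∷ 0x5126830947ab ∷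
      0x5126803947ab ∷ 0x4516b032789a ∷ 0x4516a32b7890 ∷ 0x4516a30b7892 ∷ 0x4516a032789b ∷
      0x4516903278ab ∷ 0x451682397ab0 ∷ 0x451680397ab2 ∷ 0x4516803279ab ∷ 0x4516703289ab ∷
      0x5106a32b4789 ∷ 0x5106a23b4789 ∷ 0x5106832947ab ∷ 0x5106823947ab ∷ 0x5103462789ab ∷
      0x5123460789ab ∷ 0x450793ba6812 ∷ 0x450792ba6813 ∷ 0x450791ba6823 ∷ 0x450783a96b12 ∷
      0x450782a96b13 ∷ 0x450781a96b23 ∷ 0x4507612389ab ∷ 0x5036a21b4789 ∷ 0x5036a12b4789 ∷
      0x5036821947ab ∷ 0x5036812947ab ∷ 0x5016a32b4789 ∷ 0x5016a23b4789 ∷ 0x5016832947ab ∷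
      0x5016823947ab ∷ 0x4506b123789a ∷ 0x4506a23b7891 ∷ 0x4506a21b7893 ∷ 0x4506a123789b ∷
      0x4506912378ab ∷ 0x450683297ab1 ∷ 0x450681297ab3 ∷ 0x4506812379ab ∷ 0x4506712389ab ∷
      0x5012463789ab ∷ 0x5032461789ab ∷ 0x4327a10b5689 ∷ 0x4327a01b5689 ∷ 0x432791ba5680 ∷
      0x4327910a568b ∷ 0x432790ba5681 ∷ 0x4327901a568b ∷ 0x432781a956b0 ∷ 0x4327810956ab ∷
      0x432780a956b1 ∷ 0x4327801956ab ∷ 0x4327510689ab ∷ 0x4327501689ab ∷ 0x4307a21b5689 ∷
      0x4307a12b5689 ∷ 0x430792ba5681 ∷ 0x4307921a568b ∷ 0x430791ba5682 ∷ 0x4307912a568b ∷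
      0x430782a956b1 ∷ 0x4307821956ab ∷ 0x430781a956b2 ∷ 0x4307812956ab ∷ 0x4307521689ab ∷
      0x4307512689ab ∷ 0x4365b012789a ∷ 0x4365a21b7890 ∷ 0x4365a12b7890 ∷ 0x4365a10b7892 ∷
      0x4365a01b7892 ∷ 0x4365a012789b ∷ 0x4365901278ab ∷ 0x436582197ab0 ∷ 0x436581297ab0 ∷
      0x436581097ab2 ∷ 0x436580197ab2 ∷ 0x4365801279ab ∷ 0x4365701289ab ∷ 0x4326a01b5789 ∷
      0x432691ba5780 ∷ 0x4326910a578b ∷ 0x432690ba5781 ∷ 0x4326901a578b ∷ 0x432681a957b0 ∷
      0x4326810957ab ∷ 0x432680a957b1 ∷ 0x4306a21b5789 ∷ 0x430692ba5781 ∷ 0x4306921a578b ∷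
      0x430691ba5782 ∷ 0x4306912a578b ∷ 0x430682a957b1 ∷ 0x430681a957b2 ∷ 0x4306812957ab ∷
      0x4356b012789a ∷ 0x4356a21b7890 ∷ 0x4356a12b7890 ∷ 0x4356a10b7892 ∷ 0x4356a01b7892 ∷
      0x4356a012789b ∷ 0x4356901278ab ∷ 0x435682197ab0 ∷ 0x435681297ab0 ∷ 0x435681097ab2 ∷
      0x435680197ab2 ∷ 0x4356801279ab ∷ 0x4356701289ab ∷ 0x4325a01b6789 ∷ 0x432591ba6780 ∷
      0x4325910a678b ∷ 0x432590ba6781 ∷ 0x4325901a678b ∷ 0x432581a967b0 ∷ 0x4325810967ab ∷
      0x432580a967b1 ∷ 0x4305a21b6789 ∷ 0x430592ba6781 ∷ 0x4305921a678b ∷ 0x430591ba6782 ∷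
      0x4305912a678b ∷ 0x430582a967b1 ∷ 0x430581a967b2 ∷ 0x4305812967ab ∷ 0x4237a10b5689 ∷
      0x4237a01b5689 ∷ 0x423791ba5680 ∷ 0x4237910a568b ∷ 0x423790ba5681 ∷ 0x4237901a568b ∷
      0x423781a956b0 ∷ 0x4237810956ab ∷ 0x423780a956b1 ∷ 0x4237801956ab ∷ 0x4237510689ab ∷
      0x4237501689ab ∷ 0x4217a30b5689 ∷ 0x4217a03b5689 ∷ 0x421793ba5680 ∷ 0x4217930a568b ∷
      0x421790ba5683 ∷ 0x4217903a568b ∷ 0x421783a956b0 ∷ 0x4217830956ab ∷ 0x421780a956b3 ∷
      0x4217803956ab ∷ 0x4217530689ab ∷ 0x4217503689ab ∷ 0x4236a10b5789 ∷ 0x423691ba5780 ∷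
      0x4236910a578b ∷ 0x423690ba5781 ∷ 0x4236901a578b ∷ 0x423681a957b0 ∷ 0x423680a957b1 ∷
      0x4236801957ab ∷ 0x4265b103789a ∷ 0x4265a30b7891 ∷ 0x4265a10b7893 ∷ 0x4265a103789b ∷
      0x4265a03b7891 ∷ 0x4265a01b7893 ∷ 0x4265910378ab ∷ 0x426583097ab1 ∷ 0x426581097ab3 ∷
      0x4265810379ab ∷ 0x426580397ab1 ∷ 0x426580197ab3 ∷ 0x4265710389ab ∷ 0x4216a30b5789 ∷
      0x421693ba5780 ∷ 0x4216930a578b ∷ 0x421690ba5783 ∷ 0x4216903a578b ∷ 0x421683a957b0 ∷
      0x421680a957b3 ∷ 0x4216803957ab ∷ 0x4235a10b6789 ∷ 0x423591ba6780 ∷ 0x4235910a678b ∷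
      0x423590ba6781 ∷ 0x4235901a678b ∷ 0x423581a967b0 ∷ 0x423580a967b1 ∷ 0x4235801967ab ∷
      0x4256b103789a ∷ 0x4256a30b7891 ∷ 0x4256a10b7893 ∷ 0x4256a103789b ∷ 0x4256a03b7891 ∷
      0x4256a01b7893 ∷ 0x4256910378ab ∷ 0x425683097ab1 ∷ 0x425681097ab3 ∷ 0x4256810379ab ∷
      0x425680397ab1 ∷ 0x425680197ab3 ∷ 0x4256710389ab ∷ 0x4215a30b6789 ∷ 0x421593ba6780 ∷
      0x4215930a678b ∷ 0x421590ba6783 ∷ 0x4215903a678b ∷ 0x421583a967b0 ∷ 0x421580a967b3 ∷
      0x4215803967ab ∷ 0x4127a30b5689 ∷ 0x4127a03b5689 ∷ 0x412793ba5680 ∷ 0x4127930a568b ∷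
      0x412790ba5683 ∷ 0x4127903a568b ∷ 0x412783a956b0 ∷ 0x4127830956ab ∷ 0x412780a956b3 ∷
      0x4127803956ab ∷ 0x4127530689ab ∷ 0x4127503689ab ∷ 0x4107a32b5689 ∷ 0x4107a23b5689 ∷
      0x410793ba5682 ∷ 0x4107932a568b ∷ 0x410792ba5683 ∷ 0x4107923a568b ∷ 0x410783a956b2 ∷
      0x4107832956ab ∷ 0x410782a956b3 ∷ 0x4107823956ab ∷ 0x4107532689ab ∷ 0x4107523689ab ∷
      0x4126a03b5789 ∷ 0x412693ba5780 ∷ 0x4126930a578b ∷ 0x412690ba5783 ∷ 0x4126903a578b ∷
      0x412683a957b0 ∷ 0x4126830957ab ∷ 0x412680a957b3 ∷ 0x4165b032789a ∷ 0x4165a32b7890 ∷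
      0x4165a30b7892 ∷ 0x4165a23b7890 ∷ 0x4165a03b7892 ∷ 0x4165a032789b ∷ 0x4165903278ab ∷
      0x416583297ab0 ∷ 0x416583097ab2 ∷ 0x416582397ab0 ∷ 0x416580397ab2 ∷ 0x4165803279ab ∷
      0x4165703289ab ∷ 0x4106a23b5789 ∷ 0x410693ba5782 ∷ 0x4106932a578b ∷ 0x410692ba5783 ∷
      0x4106923a578b ∷ 0x410683a957b2 ∷ 0x4106832957ab ∷ 0x410682a957b3 ∷ 0x4125a03b6789 ∷
      0x412593ba6780 ∷ 0x4125930a678b ∷ 0x412590ba6783 ∷ 0x4125903a678b ∷ 0x412583a967b0 ∷
      0x4125830967ab ∷ 0x412580a967b3 ∷ 0x4156b032789a ∷ 0x4156a32b7890 ∷ 0x4156a30b7892 ∷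
      0x4156a23b7890 ∷ 0x4156a03b7892 ∷ 0x4156a032789b ∷ 0x4156903278ab ∷ 0x415683297ab0 ∷
      0x415683097ab2 ∷ 0x415682397ab0 ∷ 0x415680397ab2 ∷ 0x4156803279ab ∷ 0x4156703289ab ∷
      0x4105a23b6789 ∷ 0x410593ba6782 ∷ 0x4105932a678b ∷ 0x410592ba6783 ∷ 0x4105923a678b ∷
      0x410583a967b2 ∷ 0x4105832967ab ∷ 0x410582a967b3 ∷ 0x4037a21b5689 ∷ 0x4037a12b5689 ∷
      0x403792ba5681 ∷ 0x4037921a568b ∷ 0x403791ba5682 ∷ 0x4037912a568b ∷ 0x403782a956b1 ∷
      0x4037821956ab ∷ 0x403781a956b2 ∷ 0x4037812956ab ∷ 0x4037521689ab ∷ 0x4037512689ab ∷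
      0x4017a32b5689 ∷ 0x4017a23b5689 ∷ 0x401793ba5682 ∷ 0x4017932a568b ∷ 0x401792ba5683 ∷
      0x4017923a568b ∷ 0x401783a956b2 ∷ 0x4017832956ab ∷ 0x401782a956b3 ∷ 0x4017823956ab ∷
      0x4017532689ab ∷ 0x4017523689ab ∷ 0x4036a12b5789 ∷ 0x403692ba5781 ∷ 0x4036921a578b ∷
      0x403691ba5782 ∷ 0x4036912a578b ∷ 0x403682a957b1 ∷ 0x4036821957ab ∷ 0x403681a957b2 ∷
      0x4016a32b5789 ∷ 0x401693ba5782 ∷ 0x4016932a578b ∷ 0x401692ba5783 ∷ 0x4016923a578b ∷
      0x401683a957b2 ∷ 0x401682a957b3 ∷ 0x4016823957ab ∷ 0x4065b123789a ∷ 0x4065a32b7891 ∷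
      0x4065a23b7891 ∷ 0x4065a21b7893 ∷ 0x4065a12b7893 ∷ 0x4065a123789b ∷ 0x4065912378ab ∷
      0x406583297ab1 ∷ 0x406582397ab1 ∷ 0x406582197ab3 ∷ 0x406581297ab3 ∷ 0x4065812379ab ∷
      0x4065712389ab ∷ 0x4035a12b6789 ∷ 0x403592ba6781 ∷ 0x4035921a678b ∷ 0x403591ba6782 ∷
      0x4035912a678b ∷ 0x403582a967b1 ∷ 0x4035821967ab ∷ 0x403581a967b2 ∷ 0x4015a32b6789 ∷
      0x401593ba6782 ∷ 0x4015932a678b ∷ 0x401592ba6783 ∷ 0x4015923a678b ∷ 0x401583a967b2 ∷
      0x401582a967b3 ∷ 0x4015823967ab ∷ 0x4056b123789a ∷ 0x4056a32b7891 ∷ 0x4056a23b7891 ∷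
      0x4056a21b7893 ∷ 0x4056a12b7893 ∷ 0x4056a123789b ∷ 0x4056912378ab ∷ 0x405683297ab1 ∷
      0x405682397ab1 ∷ 0x405682197ab3 ∷ 0x405681297ab3 ∷ 0x4056812379ab ∷ 0x4056712389ab ∷ []) ∷ []
  ; plan = ask (4 , 7) (up none 0x45670123) (ask (3 , 1) (up none 0x03124567) (ask (3 , 2) (up none 0x03214567)
    (ask (5 , 0)
      (ask (5 , 1) (up none 0x50213467) (ask (5 , 2) (up none 0x50123467)
        (ask (6 , 0)
          (ask (6 , 1) (up none 0x60213457) (ask (6 , 2) (up none 0x60123457)
            (ask (0 , 4) (up none 0x04561237) (ask (5 , 7) (up none 0x05761234)
              (use ((0 , 4) ∷ (5 , 7) ∷ (6 , 1) ∷ (3 , 2) ∷ []) pawPathOwn)))))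
          (use ((4 , 7) ∷ (6 , 0) ∷ (5 , 1) ∷ (3 , 2) ∷ []) pawPathOwn))))
      (ask (6 , 1)
        (ask (6 , 2) (up none 0x61023457) (use ((4 , 7) ∷ (5 , 0) ∷ (6 , 2) ∷ (3 , 1) ∷ []) pawPathOwn))
        (use ((4 , 7) ∷ (5 , 0) ∷ (6 , 1) ∷ (3 , 2) ∷ []) pawPathOwn)))))
  }
table none = record
  { weights = 0 ∷ 1 ∷ 2 ∷ 3 ∷ []
  ; onTri = (edge , 0x0231456 ∷ 0x0241536 ∷ 0x0251634 ∷ 0x0261345 ∷ []) ∷ []
  ; onQuad = (edge , 0x03241567 ∷ 0x12350467 ∷ 0x01243567 ∷ 0x12340567 ∷ 0x12360547 ∷ 0x03251746 ∷ 0x01253746 ∷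
      0x03261457 ∷ 0x12370645 ∷ 0x01263457 ∷ 0x12340756 ∷ 0x03271645 ∷ 0x01273645 ∷ 0x01432567 ∷
      0x01532467 ∷ 0x01632547 ∷ 0x01632745 ∷ 0x01732645 ∷ []) ∷ []
  ; plan = ask (0 , 1) (up edge 0x0123) (ask (2 , 3) (up edge 0x2301) (use ((0 , 1) ∷ (2 , 3) ∷ []) ((edge , 0x1302 ∷ []) ∷ [])))
  }
table edge = record
  { weights = 2 ∷ 3 ∷ []
  ; onTri = (matching , 0x0251634 ∷ 0x0261534 ∷ []) ∷ []
  ; onQuad = (matching , 0x03261745 ∷ 0x12370645 ∷ 0x01263745 ∷ 0x03271645 ∷ 0x12360745 ∷ 0x01273645 ∷ 0x01632745 ∷
      0x01732645 ∷ []) ∷ []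
  ; plan = ask (2 , 3) (up matching 0x0123) (use ((2 , 3) ∷ []) ((cherry , 0x0123 ∷ []) ∷ []))
  }
table matching = record
  { weights = 0 ∷ 2 ∷ 1 ∷ 3 ∷ []
  ; onTri = (cherry , 0x0341652 ∷ 0x0561432 ∷ 0x2560134 ∷ 0x2340156 ∷ []) ∷ []
  ; onQuad = (cherry , 0x01542763 ∷ 0x03541762 ∷ 0x23760451 ∷ 0x01452376 ∷ 0x03451672 ∷ 0x03251764 ∷ 0x12670543 ∷
      0x03451267 ∷ 0x23670541 ∷ 0x03261457 ∷ 0x03761542 ∷ 0x01762453 ∷ 0x23540671 ∷ 0x01263547 ∷
      0x03271456 ∷ 0x03671452 ∷ 0x01672543 ∷ 0x23450761 ∷ 0x12540367 ∷ 0x12450367 ∷ 0x01532674 ∷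
      0x23540167 ∷ 0x12760345 ∷ 0x01732456 ∷ 0x12670345 ∷ []) ∷ []
  ; plan = ask (0 , 2) (up cherry 0x1023) (ask (1 , 3) (up cherry 0x0132)
    (use ((0 , 2) ∷ (1 , 3) ∷ []) ((cherry , 0x0321 ∷ []) ∷ [])))
  }
table cherry = record
  -- The pairs are the four non-edges of a path on 0, 1, 2 with 3 isolated: 3 has weight three, the
  -- ends two each, the centre one.
  { weights = 0 ∷ 2 ∷ 3 ∷ 0 ∷ 3 ∷ 1 ∷ 3 ∷ 2 ∷ []
  ; onTri = (path₄ , 0x1260345 ∷ 0x1260543 ∷ 0x0261345 ∷ 0x0162543 ∷ 0x1254306 ∷ 0x0234516 ∷ [])
    ∷ (claw , 0x0164235 ∷ 0x0452136 ∷ 0x1452036 ∷ []) ∷ []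
  ; onQuad = (path₄ , 0x04563217 ∷ 0x04561237 ∷ 0x12370456 ∷ 0x12370654 ∷ 0x14562307 ∷ 0x03271456 ∷ 0x03271654 ∷
      0x01273456 ∷ 0x01273654 ∷ 0x34562107 ∷ 0x14560327 ∷ 0x24563017 ∷ 0x01732456 ∷ 0x01732654 ∷
      0x24561037 ∷ 0x34560127 ∷ 0x12346507 ∷ 0x12364507 ∷ 0x03264517 ∷ 0x01436527 ∷ 0x01634527 ∷ [])
    ∷ (claw , 0x12375046 ∷ 0x14563027 ∷ 0x23560147 ∷ 0x03542167 ∷ 0x01562347 ∷ 0x23651047 ∷ [])
    ∷ (triangle , 0x23650147 ∷ 0x03241567 ∷ 0x12650347 ∷ 0x01542376 ∷ 0x03541276 ∷ 0x01452367 ∷ 0x01652347 ∷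
      0x03561247 ∷ 0x01562374 ∷ 0x01263457 ∷ 0x12450376 ∷ 0x12650374 ∷ 0x23540176 ∷ []) ∷ []
  ; plan = ask (0 , 2) (up triangle 0x0123) (ask (3 , 0) (up path₄ 0x3012) (ask (3 , 1) (up claw 0x1023)
    (ask (3 , 2) (up path₄ 0x0123) (use ((0 , 2) ∷ (3 , 0) ∷ (3 , 1) ∷ (3 , 2) ∷ []) []))))
  }
table claw = record
  { weights = 1 ∷ 2 ∷ 1 ∷ 3 ∷ 2 ∷ 3 ∷ []
  ; onTri = (path₄ , 0x0241635 ∷ 0x0251436 ∷ 0x0261534 ∷ []) ∷ []
  ; onQuad = (path₄ , 0x05461237 ∷ 0x16472305 ∷ 0x03251746 ∷ 0x01253746 ∷ 0x36472105 ∷ 0x06471235 ∷ 0x15472306 ∷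
      0x03261547 ∷ 0x15462307 ∷ 0x12350746 ∷ 0x01273645 ∷ 0x25473016 ∷ 0x01632547 ∷ 0x01732645 ∷
      0x26471035 ∷ 0x35460127 ∷ []) ∷ []
  ; plan = ask (1 , 2) (up triangle 0x0123) (ask (1 , 3) (up triangle 0x0132) (ask (2 , 3) (up triangle 0x0231)
    (use ((1 , 2) ∷ (1 , 3) ∷ (2 , 3) ∷ []) [])))
  }
table path₄ = record
  { weights = 0 ∷ 2 ∷ 1 ∷ 3 ∷ []
  ; onTri = (triangle , 0x0341256 ∷ 0x0142563 ∷ 0x0241563 ∷ 0x0561234 ∷ 0x0261453 ∷ 0x0162453 ∷ [])
    ∷ (full , 0x0231456 ∷ 0x1340265 ∷ 0x2340165 ∷ []) ∷ []
  ; onQuad = (triangle , 0x12760453 ∷ 0x12360457 ∷ 0x12370456 ∷ 0x04561273 ∷ 0x25670143 ∷ 0x23650147 ∷ 0x23560147 ∷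
      0x23760145 ∷ 0x23670145 ∷ 0x35670142 ∷ 0x15670342 ∷ 0x01542367 ∷ 0x03541672 ∷ 0x03541267 ∷
      0x01243675 ∷ 0x25670341 ∷ 0x03542671 ∷ 0x12340567 ∷ 0x05672341 ∷ 0x01452367 ∷ 0x23760154 ∷
      0x03251674 ∷ 0x03451672 ∷ 0x01652347 ∷ 0x01652374 ∷ 0x03451276 ∷ 0x03651274 ∷ 0x01253674 ∷
      0x12540673 ∷ 0x12450673 ∷ 0x12350674 ∷ 0x03261457 ∷ 0x03761452 ∷ 0x03561247 ∷ 0x12450367 ∷
      0x01562374 ∷ 0x23450167 ∷ 0x01762345 ∷ 0x03561274 ∷ 0x01263457 ∷ 0x03271456 ∷ 0x14560372 ∷
      0x03271564 ∷ 0x01672453 ∷ 0x01672345 ∷ 0x12560374 ∷ 0x01673452 ∷ 0x24560173 ∷ 0x23540176 ∷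
      0x23560174 ∷ 0x34560172 ∷ 0x03672451 ∷ 0x24560371 ∷ 0x01273564 ∷ 0x23761450 ∷ 0x23671450 ∷
      0x14562370 ∷ 0x35671240 ∷ 0x15672340 ∷ 0x01532674 ∷ 0x23451670 ∷ 0x01632457 ∷ 0x01732564 ∷
      0x12673450 ∷ [])
    ∷ (full , 0x01243567 ∷ 0x05671234 ∷ 0x01762354 ∷ 0x01273456 ∷ 0x01432567 ∷ []) ∷ []
  ; plan = ask (0 , 2) (up triangle 0x0123) (ask (1 , 3) (up triangle 0x1230)
    (use ((0 , 2) ∷ (1 , 3) ∷ []) ((full , 0x0123 ∷ []) ∷ [])))
  }
table triangle = record
  { weights = 3 ∷ 0 ∷ 3 ∷ 1 ∷ 3 ∷ 2 ∷ []
  ; onTri = (paw , 0x3450126 ∷ 0x3451026 ∷ []) ∷ []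
  ; onQuad = (paw , 0x12374560 ∷ 0x12375460 ∷ 0x12376450 ∷ 0x03274561 ∷ 0x03275461 ∷ 0x03276451 ∷ 0x01274563 ∷
      0x01275463 ∷ 0x01276453 ∷ 0x01734562 ∷ 0x01735462 ∷ 0x01736452 ∷ 0x04652173 ∷ 0x04652371 ∷
      0x04562173 ∷ 0x04562371 ∷ 0x05462173 ∷ 0x05462371 ∷ 0x14653072 ∷ 0x14563072 ∷ 0x15463072 ∷
      0x24650173 ∷ 0x24560173 ∷ 0x25460173 ∷ 0x34651072 ∷ 0x34561072 ∷ 0x35461072 ∷ 0x24650371 ∷
      0x24560371 ∷ 0x25460371 ∷ 0x14653270 ∷ 0x14563270 ∷ 0x15463270 ∷ 0x34651270 ∷ 0x34561270 ∷
      0x35461270 ∷ 0x12360457 ∷ 0x12350467 ∷ 0x23650147 ∷ 0x23561047 ∷ 0x03241567 ∷ 0x12653047 ∷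
      0x01643257 ∷ 0x03642175 ∷ 0x01243567 ∷ 0x12340567 ∷ 0x12640357 ∷ 0x03251467 ∷ 0x01452367 ∷
      0x23641057 ∷ 0x03451267 ∷ 0x01652347 ∷ 0x01253467 ∷ 0x23540167 ∷ 0x03261457 ∷ 0x01462357 ∷
      0x03461257 ∷ 0x12453067 ∷ 0x03462157 ∷ 0x01263457 ∷ 0x01432567 ∷ 0x01532467 ∷ 0x01632457 ∷ []) ∷ []
  ; plan = ask (3 , 0) (up paw 0x0123) (ask (3 , 1) (up paw 0x1203) (ask (3 , 2) (up paw 0x2013)
    (use ((3 , 0) ∷ (3 , 1) ∷ (3 , 2) ∷ []) [])))
  }
-- Reached by `paw` and `full` alone, which are final and need no improvement.
table _ = record { weights = [] ; onTri = [] ; onQuad = [] ; plan = use [] [] }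

-- Verification of the tables and the climb to a final shape

-- When edges inside the shape are counted, a vertex is also paired with itself; these pairs are
-- absent from the outset and are charged as such.
loops : Shape → List (ℕ × ℕ)
loops c = map (λ i → i , i) (range 0 (order c))

data Checked (c : Shape) : Set where
  final      : c ≡ paw ⊎ c ≡ full → Checked c
  improvable : rank c < 9 → checkTri c (table c) ≡ true → checkQuad c (table c) ≡ true →
               checkPlan c (table c) (edges c) (loops c) (Table.plan (table c)) ≡ true → Checked c

-- Each `refl` of an `improvable` entry runs its search by evaluation.
checked : ∀ c → Checked c
checked path₃ = improvable (<ᵇ⇒< 0 9 _) refl refl refl
checked fan = improvable (<ᵇ⇒< 1 9 _) refl refl refl
checked paw∪path = improvable (<ᵇ⇒< 1 9 _) refl refl refl
checked none = improvable (<ᵇ⇒< 2 9 _) refl refl refl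
checked edge = improvable (<ᵇ⇒< 3 9 _) refl refl refl
checked matching = improvable (<ᵇ⇒< 4 9 _) refl refl refl
checked cherry = improvable (<ᵇ⇒< 5 9 _) refl refl refl
checked claw = improvable (<ᵇ⇒< 6 9 _) refl refl refl
checked path₄ = improvable (<ᵇ⇒< 7 9 _) refl refl refl
checked triangle = improvable (<ᵇ⇒< 8 9 _) refl refl refl
checked paw = final (inj₁ refl)
checked full = final (inj₂ refl)

module Climb {n : ℕ} (A : Fin n → Fin n → Bool) (A-sym : ∀ x y → A x y ≡ A y x)
  (A-irr : ∀ x → A x x ≡ false) (r s : ℕ)
  (ore : ∀ x y → x ≢ y → A x y ≡ false →
         4 * (r + s) ≤ Packings.hits A x (allFin n) + Packings.hits A y (allFin n))
  where

  open Packings A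
  open Engine A A-sym r s ore

  Done : Set
  Done = Has paw ⊎ Has full

  no-loops : ∀ v is → All (Unlinked v) (map (λ i → i , i) is)
  no-loops v [] = []
  no-loops v (i ∷ is) = A-irr (v i) ∷ no-loops v is

  -- Every improvement raises the rank, so the fuel can run out only at rank 9, where no shape is
  -- improvable.
  climb : ∀ f c → 9 ≤ f + rank c → Has c → Done
  climb f c le h with checked c
  climb f c le h | final (inj₁ refl) = inj₁ h
  climb f c le h | final (inj₂ refl) = inj₂ h
  climb zero c le h | improvable lt _ _ _ = contradiction le (<⇒≱ lt)
  climb (suc f) c le (has te qe v st links) | improvable _ tri-ok quad-ok plan-ok
    with follow c (table c) tri-ok quad-ok te qe v st links (edges c) (loops c)
           (Table.plan (table c)) plan-ok links (no-loops v (range 0 (order c)))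
  ... | c′ , lt , h′ = climb f c′
        (≤-trans le (≤-trans (≤-reflexive (sym (+-suc f (rank c)))) (+-monoʳ-≤ f lt))) h′

  -- Base case of the edge deletion: the vertex list is cut into triples and then quadruples, whose
  -- vertices are distinct and hence adjacent. `x₀` is a default value for the vertex map of the
  -- empty shape.
  complete : V → length (allFin n) ≡ extent r s 0 → (∀ x y → x ≢ y → x ~ y) → Has full
  complete x₀ len adj = fill r s len refl refl (start ↭-refl)
    where
    fill : ∀ r′ s′ {t q L} → length L ≡ extent r′ s′ 0 → t + r′ ≡ r → q + s′ ≡ s → St t q L → Has full
    fill zero zero {L = []} len te qe st = has te qe (λ _ → x₀) st []
    fill zero (suc s′) {q = q} {a ∷ b ∷ c ∷ d ∷ L} len te qe st with St-unique st
    ... | (ab ∷ _ ∷ ad ∷ _) ∷ (bc ∷ _) ∷ (cd ∷ _) ∷ _ =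
      fill zero s′ (cong (_∸ 4) len) te (≡.trans (sym (+-suc q s′)) qe)
        (quad a b c d (adj a b ab) (adj b c bc) (adj c d cd) (adj d a (ad ∘ sym)) st)
    fill (suc r′) s′ {t = t} {L = a ∷ b ∷ c ∷ L} len te qe st with St-unique st
    ... | (ab ∷ ac ∷ _) ∷ (bc ∷ _) ∷ _ =
      fill r′ s′ (cong (_∸ 3) len) (≡.trans (sym (+-suc t r′)) te) qe
        (tri a b c (adj a b ab) (adj b c bc) (adj c a (ac ∘ sym)) st)

-- Deleting one edge from a packed graph

module _ {n : ℕ} (A : Fin n → Fin n → Bool) (x : Fin n) where

  open Packings A

  data Holder (t q : ℕ) (L : List V) : Set where
    free   : x ∈ L → Holder t q L
    inTri  : ∀ {t′} b c → suc t′ ≡ t → x ~ b → b ~ c → c ~ x → St t′ q (x ∷ b ∷ c ∷ L) → Holder t q L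
    inQuad : ∀ {q′} b c d → suc q′ ≡ q → x ~ b → b ~ c → c ~ d → d ~ x →
             St t q′ (x ∷ b ∷ c ∷ d ∷ L) → Holder t q L

  rotate₃ : ∀ (a b c : V) L → a ∷ b ∷ c ∷ L ↭ b ∷ c ∷ a ∷ L
  rotate₃ a b c L = ++-swap (a ∷ []) (b ∷ c ∷ []) L

  rotate₄ : ∀ (a b c d : V) L → a ∷ b ∷ c ∷ d ∷ L ↭ b ∷ c ∷ d ∷ a ∷ L
  rotate₄ a b c d L = ++-swap (a ∷ []) (b ∷ c ∷ d ∷ []) L

  -- `x` starts out uncovered and is followed until a block takes it up. That block is rotated to
  -- begin with `x`, and the blocks around it are closed again over the opened state.
  holder : ∀ {t q L} → St t q L → Holder t q L
  holder (start p) = free (∈-resp-↭ (↭-sym p) (∈-allFin x))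
  holder {L = L} (tri a b c ab bc ca st) with holder st
  ... | free (here refl) = inTri b c refl ab bc ca st
  ... | free (there (here refl)) = inTri c a refl bc ca ab (St-↭ (rotate₃ a b c L) st)
  ... | free (there (there (here refl))) =
        inTri a b refl ca ab bc (St-↭ (↭-trans (rotate₃ a b c L) (rotate₃ b c a L)) st)
  ... | free (there (there (there m))) = free m
  ... | inTri y z refl xy yz zx st′ =
        inTri y z refl xy yz zx (tri a b c ab bc ca (St-↭ (++-swap (x ∷ y ∷ z ∷ []) (a ∷ b ∷ c ∷ []) L) st′))
  ... | inQuad y z w refl xy yz zw wx st′ =
        inQuad y z w refl xy yz zw wx
          (tri a b c ab bc ca (St-↭ (++-swap (x ∷ y ∷ z ∷ w ∷ []) (a ∷ b ∷ c ∷ []) L) st′))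
  holder {L = L} (quad a b c d ab bc cd da st) with holder st
  ... | free (here refl) = inQuad b c d refl ab bc cd da st
  ... | free (there (here refl)) = inQuad c d a refl bc cd da ab (St-↭ (rotate₄ a b c d L) st)
  ... | free (there (there (here refl))) =
        inQuad d a b refl cd da ab bc (St-↭ (↭-trans (rotate₄ a b c d L) (rotate₄ b c d a L)) st)
  ... | free (there (there (there (here refl)))) =
        inQuad a b c refl da ab bc cd
          (St-↭ (↭-trans (rotate₄ a b c d L) (↭-trans (rotate₄ b c d a L) (rotate₄ c d a b L))) st)
  ... | free (there (there (there (there m)))) = free m
  ... | inTri y z refl xy yz zx st′ =
        inTri y z refl xy yz zx
          (quad a b c d ab bc cd da (St-↭ (++-swap (x ∷ y ∷ z ∷ []) (a ∷ b ∷ c ∷ d ∷ []) L) st′))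
  ... | inQuad y z w refl xy yz zw wx st′ =
        inQuad y z w refl xy yz zw wx
          (quad a b c d ab bc cd da (St-↭ (++-swap (x ∷ y ∷ z ∷ w ∷ []) (a ∷ b ∷ c ∷ d ∷ []) L) st′))

record Ore {n : ℕ} (A : Fin n → Fin n → Bool) (k : ℕ) : Set where
  field
    symmetric   : ∀ x y → A x y ≡ A y x
    irreflexive : ∀ x → A x x ≡ false
    heavy       : ∀ x y → x ≢ y → A x y ≡ false →
                  k ≤ Packings.hits A x (allFin n) + Packings.hits A y (allFin n)

-- `A₁` plays the part of `A` with the edge `xy` added: edges away from `x` survive in `A`, and at
-- `x` only the edge to `y` can be lost.
module _ {n r s : ℕ} (A A₁ : Fin n → Fin n → Bool) (x y : Fin n)
  (A-ore : Ore A (4 * (r + s))) (A₁-ore : Ore A₁ (4 * (r + s)))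
  (away : ∀ u w → u ≢ x → w ≢ x → A₁ u w ≡ true → A u w ≡ true)
  (near : ∀ w → A₁ x w ≡ true → A x w ≡ true ⊎ w ≡ y)
  where

  private
    module O = Ore A-ore
    module O₁ = Ore A₁-ore
    open Packings A
    module P₁ = Packings A₁
    open Engine A O.symmetric r s O.heavy
    open Climb A O.symmetric O.irreflexive r s O.heavy
    module E₁ = Engine A₁ O₁.symmetric r s O₁.heavy
    module C₁ = Climb A₁ O₁.symmetric O₁.irreflexive r s O₁.heavy

  -- If `x` is uncovered, every block avoids it by distinctness, so no block uses the deleted edge.
  restrict : ∀ {t q L} → x ∈ L → P₁.St t q L → St t q L
  restrict m (P₁.start p) = start p
  restrict m (P₁.tri a b c ab bc ca st) with P₁.St-unique st
  ... | (_ ∷ _ ∷ a∉) ∷ (_ ∷ b∉) ∷ c∉ ∷ _ =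
        tri a b c (away a b a≢ b≢ ab) (away b c b≢ c≢ bc) (away c a c≢ a≢ ca)
          (restrict (there (there (there m))) st)
    where
    a≢ = All.lookup a∉ m
    b≢ = All.lookup b∉ m
    c≢ = All.lookup c∉ m
  restrict m (P₁.quad a b c d ab bc cd da st) with P₁.St-unique st
  ... | (_ ∷ _ ∷ _ ∷ a∉) ∷ (_ ∷ _ ∷ b∉) ∷ (_ ∷ c∉) ∷ d∉ ∷ _ =
        quad a b c d (away a b a≢ b≢ ab) (away b c b≢ c≢ bc) (away c d c≢ d≢ cd) (away d a d≢ a≢ da)
          (restrict (there (there (there (there m)))) st)
    where
    a≢ = All.lookup a∉ m
    b≢ = All.lookup b∉ m
    c≢ = All.lookup c∉ m
    d≢ = All.lookup d∉ m

  flip~ : ∀ {u w} → u ~ w → w ~ u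
  flip~ {u} {w} uw = ≡.trans (O.symmetric w u) uw

  -- A cycle through `x` has two edges at `x`, and at most one of them leads to `y`.
  two-near : ∀ {b c} → b ≢ c → A₁ x b ≡ true → A₁ x c ≡ true → (x ~ b × x ~ c) ⊎ (x ~ b ⊎ x ~ c)
  two-near {b} {c} b≢c xb xc with near b xb | near c xc
  ... | inj₁ p | inj₁ q = inj₁ (p , q)
  ... | inj₁ p | inj₂ _ = inj₂ (inj₁ p)
  ... | inj₂ _ | inj₁ q = inj₂ (inj₂ q)
  ... | inj₂ p | inj₂ q = contradiction (≡.trans p (sym q)) b≢c

  three : V → V → V → ℕ → V
  three a b c = a ◂ (b ◂ (λ _ → c))

  four : V → V → V → V → ℕ → V
  four a b c d = a ◂ (b ◂ (c ◂ (λ _ → d)))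

  flip₁ : ∀ {u w} → A₁ u w ≡ true → A₁ w u ≡ true
  flip₁ {u} {w} uw = ≡.trans (O₁.symmetric w u) uw

  finish : ∀ c → Has c → Done
  finish c = climb 9 c (m≤m+n 9 (rank c))

  data Remnant₃ (b c : V) : Set where
    whole : x ~ b → b ~ c → c ~ x → Remnant₃ b c
    broken : ∀ p q u → x ∷ b ∷ c ∷ [] ↭ p ∷ q ∷ u ∷ [] → p ~ q → q ~ u → Remnant₃ b c

  remnant₃ : ∀ {b c} → b ≢ x → c ≢ x → b ≢ c →
    A₁ x b ≡ true → A₁ b c ≡ true → A₁ c x ≡ true → Remnant₃ b c
  remnant₃ {b} {c} b≢ c≢ b≢c xb bc cx with away b c b≢ c≢ bc | two-near b≢c xb (flip₁ cx)
  ... | bc′ | inj₁ (p , q) = whole p bc′ (flip~ q)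
  ... | bc′ | inj₂ (inj₁ p) = broken x b c ↭-refl p bc′
  ... | bc′ | inj₂ (inj₂ q) = broken b c x (++-comm (x ∷ []) (b ∷ c ∷ [])) bc′ (flip~ q)

  data Remnant₄ (b c d : V) : Set where
    whole : x ~ b → b ~ c → c ~ d → d ~ x → Remnant₄ b c d
    broken : ∀ p q u w → x ∷ b ∷ c ∷ d ∷ [] ↭ p ∷ q ∷ u ∷ w ∷ [] → p ~ q → q ~ u → u ~ w → Remnant₄ b c d

  remnant₄ : ∀ {b c d} → b ≢ x → c ≢ x → d ≢ x → b ≢ d →
    A₁ x b ≡ true → A₁ b c ≡ true → A₁ c d ≡ true → A₁ d x ≡ true → Remnant₄ b c d
  remnant₄ {b} {c} {d} b≢ c≢ d≢ b≢d xb bc cd dx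
    with away b c b≢ c≢ bc | away c d c≢ d≢ cd | two-near b≢d xb (flip₁ dx)
  ... | bc′ | cd′ | inj₁ (p , q) = whole p bc′ cd′ (flip~ q)
  ... | bc′ | cd′ | inj₂ (inj₁ p) = broken x b c d ↭-refl p bc′ cd′
  ... | bc′ | cd′ | inj₂ (inj₂ q) = broken b c d x (++-comm (x ∷ []) (b ∷ c ∷ d ∷ [])) bc′ cd′ (flip~ q)

  -- Everything is covered, so `x` lies in a block. A damaged triangle leaves `path₃`; a damaged
  -- quadrilateral leaves `path₄` beside s - 1 intact ones.
  from-full : E₁.Has full → Done
  from-full (E₁.has {t} {q} te qe v st _) with holder A₁ x st
  ... | inTri b c refl xb bc cx st′ with P₁.St-unique st′
  ...   | (x≢b ∷ x≢c ∷ []) ∷ (b≢c ∷ []) ∷ _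
    with remnant₃ (x≢b ∘ sym) (x≢c ∘ sym) b≢c xb bc cx | restrict (here refl) st′
  ...     | whole xb′ bc′ cx′ | st″ = inj₂ (has te qe v (tri x b c xb′ bc′ cx′ st″) [])
  ...     | broken p u w perm pu uw | st″ = finish path₃
            (has (≡.trans (+-suc _ 0) te) qe (three p u w) (St-↭ perm st″) (pu ∷ uw ∷ []))
  from-full (E₁.has {t} {q} te qe v st _) | inQuad b c d refl xb bc cd dx st′ with P₁.St-unique st′
  ...   | (x≢b ∷ x≢c ∷ x≢d ∷ []) ∷ (_ ∷ b≢d ∷ []) ∷ _
    with remnant₄ (x≢b ∘ sym) (x≢c ∘ sym) (x≢d ∘ sym) b≢d xb bc cd dx | restrict (here refl) st′
  ...     | whole xb′ bc′ cd′ dx′ | st″ = inj₂ (has te qe v (quad x b c d xb′ bc′ cd′ dx′ st″) [])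
  ...     | broken p u w z perm pu uw wz | st″ = finish path₄
            (has te (≡.trans (+-suc _ 0) qe) (four p u w z) (St-↭ perm st″) (pu ∷ uw ∷ wz ∷ []))

  swap-outer : ∀ (a b c d : V) → a ∷ b ∷ c ∷ d ∷ [] ↭ c ∷ b ∷ a ∷ d ∷ []
  swap-outer a b c d = ↭-trans (rotate₃ A x a b c (d ∷ [])) (swap b c ↭-refl)

  from-paw : E₁.Has paw → Done
  from-paw (E₁.has {t} {q} te qe v st (e₀₁ ∷ e₁₂ ∷ e₂₀ ∷ e₀₃ ∷ [])) =
    go (v 0) (v 1) (v 2) (v 3) st e₀₁ e₁₂ e₂₀ e₀₃
    where
    go : ∀ a b c d → P₁.St t q (a ∷ b ∷ c ∷ d ∷ []) → A₁ a b ≡ true → A₁ b c ≡ true → A₁ c a ≡ true →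
         A₁ a d ≡ true → Done
    go a b c d st ab bc ca ad with holder A₁ x st
    ... | free m with P₁.St-unique st | restrict m st
    go a b c d st ab bc ca ad | free (here refl)
      | (x≢b ∷ x≢c ∷ x≢d ∷ []) ∷ (b≢c ∷ b≢d ∷ []) ∷ (c≢d ∷ []) ∷ _ | st′
      with away b c (x≢b ∘ sym) (x≢c ∘ sym) bc | near b ab | near c (flip₁ ca) | near d ad
    ... | bc′ | inj₁ xb | inj₁ xc | inj₁ xd =
          inj₁ (has te qe (four x b c d) st′ (xb ∷ bc′ ∷ flip~ xc ∷ xd ∷ []))
    ... | bc′ | inj₁ xb | inj₁ xc | inj₂ _ =
          finish triangle (has te qe (four x b c d) st′ (xb ∷ bc′ ∷ flip~ xc ∷ []))
    ... | bc′ | inj₁ xb | inj₂ _ | inj₁ xd =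
          finish path₄ (has te qe (four c b x d) (St-↭ (swap-outer _ _ _ _) st′) (flip~ bc′ ∷ flip~ xb ∷ xd ∷ []))
    ... | bc′ | inj₂ _ | inj₁ xc | inj₁ xd =
          finish path₄ (has te qe (four b c x d) (St-↭ (rotate₃ A x _ _ _ _) st′) (bc′ ∷ flip~ xc ∷ xd ∷ []))
    ... | _ | inj₁ _ | inj₂ p | inj₂ q = contradiction (≡.trans p (sym q)) c≢d
    ... | _ | inj₂ p | inj₂ q | _ = contradiction (≡.trans p (sym q)) b≢c
    ... | _ | inj₂ p | inj₁ _ | inj₂ q = contradiction (≡.trans p (sym q)) b≢d
    go a b c d st ab bc ca ad | free (there (here refl))
      | (a≢x ∷ a≢c ∷ _ ∷ []) ∷ (x≢c ∷ x≢d ∷ []) ∷ _ | st′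
      with away c a (x≢c ∘ sym) a≢x ca | away a d a≢x (x≢d ∘ sym) ad | two-near a≢c (flip₁ ab) bc
    ... | ca′ | ad′ | inj₁ (xa , xc) = inj₁ (has te qe (four a x c d) st′ (flip~ xa ∷ xc ∷ ca′ ∷ ad′ ∷ []))
    ... | ca′ | ad′ | inj₂ (inj₁ xa) =
          finish claw (has te qe (four a x c d) st′ (flip~ xa ∷ flip~ ca′ ∷ ad′ ∷ []))
    ... | ca′ | ad′ | inj₂ (inj₂ xc) =
          finish path₄ (has te qe (four x c a d) (St-↭ (rotate₃ A x _ _ _ _) st′) (xc ∷ ca′ ∷ ad′ ∷ []))
    go a b c d st ab bc ca ad | free (there (there (here refl)))
      | (a≢b ∷ a≢x ∷ _ ∷ []) ∷ (b≢x ∷ _ ∷ []) ∷ (x≢d ∷ []) ∷ _ | st′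
      with away a b a≢x b≢x ab | away a d a≢x (x≢d ∘ sym) ad | two-near a≢b ca (flip₁ bc)
    ... | ab′ | ad′ | inj₁ (xa , xb) = inj₁ (has te qe (four a b x d) st′ (ab′ ∷ flip~ xb ∷ xa ∷ ad′ ∷ []))
    ... | ab′ | ad′ | inj₂ (inj₁ xa) =
          finish claw (has te qe (four a b x d) st′ (ab′ ∷ flip~ xa ∷ ad′ ∷ []))
    ... | ab′ | ad′ | inj₂ (inj₂ xb) =
          finish path₄ (has te qe (four x b a d) (St-↭ (swap-outer _ _ _ _) st′) (xb ∷ flip~ ab′ ∷ ad′ ∷ []))
    -- Here `x` is the pendant vertex: whether or not its edge survives, the triangle avoids `x` and
    -- stays intact.
    go a b c d st ab bc ca ad | free (there (there (there (here refl))))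
      | (_ ∷ _ ∷ a≢x ∷ []) ∷ (_ ∷ b≢x ∷ []) ∷ (c≢x ∷ []) ∷ _ | st′ =
      finish triangle (has te qe (four a b c x) st′
        (away a b a≢x b≢x ab ∷ away b c b≢x c≢x bc ∷ away c a c≢x a≢x ca ∷ []))
    go a b c d st ab bc ca ad | inTri y z refl xy yz zx st′
      with P₁.St-unique st′ | restrict (here refl) st′
    ... | (x≢y ∷ x≢z ∷ x≢a ∷ x≢b ∷ x≢c ∷ x≢d ∷ []) ∷ (y≢z ∷ _) ∷ _ | st″
      with remnant₃ (x≢y ∘ sym) (x≢z ∘ sym) y≢z xy yz zx
         | away a b (x≢a ∘ sym) (x≢b ∘ sym) ab | away b c (x≢b ∘ sym) (x≢c ∘ sym) bc
         | away c a (x≢c ∘ sym) (x≢a ∘ sym) ca | away a d (x≢a ∘ sym) (x≢d ∘ sym) ad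
    ... | whole xy′ yz′ zx′ | ab′ | bc′ | ca′ | ad′ =
          inj₁ (has te qe (four a b c d) (tri x y z xy′ yz′ zx′ st″) (ab′ ∷ bc′ ∷ ca′ ∷ ad′ ∷ []))
    -- The triangle of the paw replaces the damaged one; the remaining path and the pendant vertex
    -- form a `cherry`.
    ... | broken p u w perm pu uw | ab′ | bc′ | ca′ | ad′ =
          finish cherry (has te qe (four p u w d)
            (tri a b c ab′ bc′ ca′ (St-↭ (↭-trans (++⁺ʳ (a ∷ b ∷ c ∷ d ∷ []) perm)
              (++-swap (p ∷ u ∷ w ∷ []) (a ∷ b ∷ c ∷ []) (d ∷ []))) st″)) (pu ∷ uw ∷ []))
    go a b c d st ab bc ca ad | inQuad y z g refl xy yz zg gx st′
      with P₁.St-unique st′ | restrict (here refl) st′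
    ... | (x≢y ∷ x≢z ∷ x≢g ∷ x≢a ∷ x≢b ∷ x≢c ∷ x≢d ∷ []) ∷ (_ ∷ y≢g ∷ _) ∷ _ | st″
      with remnant₄ (x≢y ∘ sym) (x≢z ∘ sym) (x≢g ∘ sym) y≢g xy yz zg gx
         | away a b (x≢a ∘ sym) (x≢b ∘ sym) ab | away b c (x≢b ∘ sym) (x≢c ∘ sym) bc
         | away c a (x≢c ∘ sym) (x≢a ∘ sym) ca | away a d (x≢a ∘ sym) (x≢d ∘ sym) ad
    ... | whole xy′ yz′ zg′ gx′ | ab′ | bc′ | ca′ | ad′ =
          inj₁ (has te qe (four a b c d) (quad x y z g xy′ yz′ zg′ gx′ st″) (ab′ ∷ bc′ ∷ ca′ ∷ ad′ ∷ []))
    -- No quadrilateral is at hand to replace the damaged one, so the paw and the remaining path are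
    -- kept together as uncovered vertices.
    ... | broken p u w k perm pu uw wk | ab′ | bc′ | ca′ | ad′ =
          finish paw∪path (has te (≡.trans (+-suc _ 1) qe) (a ◂ (b ◂ (c ◂ (d ◂ four p u w k))))
            (St-↭ (↭-trans (++⁺ʳ (a ∷ b ∷ c ∷ d ∷ []) perm)
              (++-comm (p ∷ u ∷ w ∷ k ∷ []) (a ∷ b ∷ c ∷ d ∷ []))) st″)
            (ab′ ∷ bc′ ∷ ca′ ∷ ad′ ∷ pu ∷ uw ∷ wk ∷ []))

  step : C₁.Done → Done
  step (inj₁ h) = from-paw h
  step (inj₂ h) = from-full h

-- Induction over the missing edges

addEdge : ∀ {n} → (Fin n → Fin n → Bool) → Fin n → Fin n → Fin n → Fin n → Bool
addEdge A x y u w = A u w ∨ (⌊ u ≟ x ⌋ ∧ ⌊ w ≟ y ⌋) ∨ (⌊ u ≟ y ⌋ ∧ ⌊ w ≟ x ⌋)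

module _ {n r s : ℕ} (x₀ : Fin n) (size : n ≡ extent r s 0) where

  Goal : (A : Fin n → Fin n → Bool) → Ore A (4 * (r + s)) → Set
  Goal A O = Climb.Done A (Ore.symmetric O) (Ore.irreflexive O) r s (Ore.heavy O)

  -- Induction on a list containing all non-adjacent pairs: the first is added as an edge, the
  -- larger graph is packed, and `step` returns to `A`. With the list exhausted the graph is
  -- complete.
  pack : ∀ ps A (O : Ore A (4 * (r + s))) → (∀ x y → x ≢ y → A x y ≡ false → (x , y) ∈ ps) → Goal A O
  pack [] A O missing-in = inj₂
    (Climb.complete A (Ore.symmetric O) (Ore.irreflexive O) r s (Ore.heavy O) x₀
      (≡.trans (length-tabulate id) size) adjacent)
    where
    adjacent : ∀ x y → x ≢ y → A x y ≡ true
    adjacent x y x≢y with A x y in eq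
    ... | true = refl
    ... | false with () ← missing-in x y x≢y eq
  pack ((x , y) ∷ ps) A O missing-in with x ≟ y | A x y in xy
  ... | yes x≡y | _ = pack ps A O λ u w u≢w uw → drop u≢w (missing-in u w u≢w uw)
    where
    drop : ∀ {u w} → u ≢ w → (u , w) ∈ (x , y) ∷ ps → (u , w) ∈ ps
    drop u≢w (here refl) = contradiction x≡y u≢w
    drop u≢w (there m) = m
  ... | no _ | true = pack ps A O λ u w u≢w uw → drop uw (missing-in u w u≢w uw)
    where
    drop : ∀ {u w} → A u w ≡ false → (u , w) ∈ (x , y) ∷ ps → (u , w) ∈ ps
    drop uw (here refl) = contradiction (≡.trans (sym xy) uw) λ ()
    drop uw (there m) = m
  ... | no x≢y | false = step A A₁ x y O O₁ away near
        (pack ps A₁ O₁ λ u w u≢w uw → drop uw (missing-in u w u≢w (below uw)))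
    where
    A₁ = addEdge A x y
    ∨-false : ∀ a {b} → a ∨ b ≡ false → a ≡ false × b ≡ false
    ∨-false false eq = refl , eq
    below : ∀ {u w} → A₁ u w ≡ false → A u w ≡ false
    below {u} {w} eq = proj₁ (∨-false (A u w) eq)
    drop : ∀ {u w} → A₁ u w ≡ false → (u , w) ∈ (x , y) ∷ ps → (u , w) ∈ ps
    drop uw (here refl) with x ≟ x | y ≟ y
    ... | yes _ | yes _ = contradiction (≡.trans (sym (∨-zeroʳ (A x y))) uw) λ ()
    ... | no ne | _ = contradiction refl ne
    ... | _ | no ne = contradiction refl ne
    drop uw (there m) = m
    away : ∀ u w → u ≢ x → w ≢ x → A₁ u w ≡ true → A u w ≡ true
    away u w u≢ w≢ eq with A u w | u ≟ x | u ≟ y | w ≟ x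
    ... | true | _ | _ | _ = refl
    ... | false | yes p | _ | _ = contradiction p u≢
    ... | false | no _ | _ | yes p = contradiction p w≢
    ... | false | no _ | yes _ | no _ = eq
    ... | false | no _ | no _ | no _ = eq
    near : ∀ w → A₁ x w ≡ true → A x w ≡ true ⊎ w ≡ y
    near w eq with A x w | w ≟ y
    ... | true | _ = inj₁ refl
    ... | false | yes p = inj₂ p
    ... | false | no _ with x ≟ x | x ≟ y
    ...   | yes _ | yes p = contradiction p x≢y
    ...   | yes _ | no _ = contradiction eq λ ()
    ...   | no ne | _ = contradiction refl ne
    hits-mono : ∀ u zs → Packings.hits A u zs ≤ Packings.hits A₁ u zs
    hits-mono u [] = z≤n
    hits-mono u (z ∷ zs) with A u z
    ... | true = s≤s (hits-mono u zs)
    ... | false = ≤-trans (hits-mono u zs) (m≤n+m _ _)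
    -- A new edge creates no non-adjacent pair and lowers no degree.
    O₁ : Ore A₁ (4 * (r + s))
    O₁ = record
      { symmetric = λ u w → cong₂ _∨_ (Ore.symmetric O u w)
          (≡.trans (∨-comm (⌊ u ≟ x ⌋ ∧ ⌊ w ≟ y ⌋) _)
            (cong₂ _∨_ (∧-comm (⌊ u ≟ y ⌋) _) (∧-comm (⌊ u ≟ x ⌋) _)))
      ; irreflexive = loop-free
      ; heavy = λ u w u≢w uw → ≤-trans (Ore.heavy O u w u≢w (below uw))
          (+-mono-≤ (hits-mono u (allFin n)) (hits-mono w (allFin n)))
      }
      where
      loop-free : ∀ u → A₁ u u ≡ false
      loop-free u rewrite Ore.irreflexive O u with u ≟ x | u ≟ y
      ... | yes p | yes q = contradiction (≡.trans (sym p) q) x≢y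
      ... | yes _ | no _ = refl
      ... | no _ | yes _ = refl
      ... | no _ | no _ = refl

-- Reading off the packing

module Extract {n : ℕ} (A : Fin n → Fin n → Bool) where

  open Packings A

  Slot : ℕ → ℕ → ℕ → Set
  Slot t q l = (Σ (Fin t) (λ _ → Fin 3) ⊎ Σ (Fin q) (λ _ → Fin 4)) ⊎ Fin l

  triangles : ∀ {t q L} → St t q L → Fin t → Fin 3 → V
  triangles (tri a b c _ _ _ st) zero = lookup (a ∷ b ∷ c ∷ [])
  triangles (tri a b c _ _ _ st) (suc i) = triangles st i
  triangles (quad a b c d _ _ _ _ st) = triangles st

  quads : ∀ {t q L} → St t q L → Fin q → Fin 4 → V
  quads (tri a b c _ _ _ st) = quads st
  quads (quad a b c d _ _ _ _ st) zero = lookup (a ∷ b ∷ c ∷ d ∷ [])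
  quads (quad a b c d _ _ _ _ st) (suc i) = quads st i

  vertex : ∀ {t q L} → St t q L → Slot t q (length L) → V
  vertex st (inj₁ (inj₁ (i , k))) = triangles st i k
  vertex st (inj₁ (inj₂ (j , k))) = quads st j k
  vertex {L = L} st (inj₂ k) = lookup L k

  -- Breaking the outermost triangle sends its slots to the front of the uncovered list; the left
  -- inverse `close₃` shows that no two slots are merged.
  open₃ : ∀ {t q l} → Slot (suc t) q l → Slot t q (3 + l)
  open₃ {l = l} (inj₁ (inj₁ (zero , k))) = inj₂ (k ↑ˡ l)
  open₃ (inj₁ (inj₁ (suc i , k))) = inj₁ (inj₁ (i , k))
  open₃ (inj₁ (inj₂ j)) = inj₁ (inj₂ j)
  open₃ (inj₂ k) = inj₂ (3 ↑ʳ k)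

  close₃ : ∀ {t q l} → Slot t q (3 + l) → Slot (suc t) q l
  close₃ (inj₁ (inj₁ (i , k))) = inj₁ (inj₁ (suc i , k))
  close₃ (inj₁ (inj₂ j)) = inj₁ (inj₂ j)
  close₃ (inj₂ 0F) = inj₁ (inj₁ (zero , 0F))
  close₃ (inj₂ 1F) = inj₁ (inj₁ (zero , 1F))
  close₃ (inj₂ 2F) = inj₁ (inj₁ (zero , 2F))
  close₃ (inj₂ (suc (suc (suc k)))) = inj₂ k

  close-open₃ : ∀ {t q l} (z : Slot (suc t) q l) → close₃ (open₃ z) ≡ z
  close-open₃ (inj₁ (inj₁ (zero , 0F))) = refl
  close-open₃ (inj₁ (inj₁ (zero , 1F))) = refl
  close-open₃ (inj₁ (inj₁ (zero , 2F))) = refl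
  close-open₃ (inj₁ (inj₁ (suc i , k))) = refl
  close-open₃ (inj₁ (inj₂ j)) = refl
  close-open₃ (inj₂ k) = refl

  open₄ : ∀ {t q l} → Slot t (suc q) l → Slot t q (4 + l)
  open₄ {l = l} (inj₁ (inj₂ (zero , k))) = inj₂ (k ↑ˡ l)
  open₄ (inj₁ (inj₂ (suc j , k))) = inj₁ (inj₂ (j , k))
  open₄ (inj₁ (inj₁ i)) = inj₁ (inj₁ i)
  open₄ (inj₂ k) = inj₂ (4 ↑ʳ k)

  close₄ : ∀ {t q l} → Slot t q (4 + l) → Slot t (suc q) l
  close₄ (inj₁ (inj₂ (j , k))) = inj₁ (inj₂ (suc j , k))
  close₄ (inj₁ (inj₁ i)) = inj₁ (inj₁ i)
  close₄ (inj₂ 0F) = inj₁ (inj₂ (zero , 0F))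
  close₄ (inj₂ 1F) = inj₁ (inj₂ (zero , 1F))
  close₄ (inj₂ 2F) = inj₁ (inj₂ (zero , 2F))
  close₄ (inj₂ 3F) = inj₁ (inj₂ (zero , 3F))
  close₄ (inj₂ (suc (suc (suc (suc k))))) = inj₂ k

  close-open₄ : ∀ {t q l} (z : Slot t (suc q) l) → close₄ (open₄ z) ≡ z
  close-open₄ (inj₁ (inj₂ (zero , 0F))) = refl
  close-open₄ (inj₁ (inj₂ (zero , 1F))) = refl
  close-open₄ (inj₁ (inj₂ (zero , 2F))) = refl
  close-open₄ (inj₁ (inj₂ (zero , 3F))) = refl
  close-open₄ (inj₁ (inj₂ (suc j , k))) = refl
  close-open₄ (inj₁ (inj₁ i)) = refl
  close-open₄ (inj₂ k) = refl

  vertex-open₃ : ∀ {t q L a b c ab bc ca} (st : St t q (a ∷ b ∷ c ∷ L)) z →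
    vertex (tri a b c ab bc ca st) z ≡ vertex st (open₃ z)
  vertex-open₃ st (inj₁ (inj₁ (zero , 0F))) = refl
  vertex-open₃ st (inj₁ (inj₁ (zero , 1F))) = refl
  vertex-open₃ st (inj₁ (inj₁ (zero , 2F))) = refl
  vertex-open₃ st (inj₁ (inj₁ (suc i , k))) = refl
  vertex-open₃ st (inj₁ (inj₂ j)) = refl
  vertex-open₃ st (inj₂ k) = refl

  vertex-open₄ : ∀ {t q L a b c d ab bc cd da} (st : St t q (a ∷ b ∷ c ∷ d ∷ L)) z →
    vertex (quad a b c d ab bc cd da st) z ≡ vertex st (open₄ z)
  vertex-open₄ st (inj₁ (inj₂ (zero , 0F))) = refl
  vertex-open₄ st (inj₁ (inj₂ (zero , 1F))) = refl
  vertex-open₄ st (inj₁ (inj₂ (zero , 2F))) = refl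
  vertex-open₄ st (inj₁ (inj₂ (zero , 3F))) = refl
  vertex-open₄ st (inj₁ (inj₂ (suc j , k))) = refl
  vertex-open₄ st (inj₁ (inj₁ i)) = refl
  vertex-open₄ st (inj₂ k) = refl

  lookup-injective : ∀ {L : List V} → Unique L → ∀ {i j} → lookup L i ≡ lookup L j → i ≡ j
  lookup-injective (_ ∷ _) {zero} {zero} eq = refl
  lookup-injective {x ∷ L} (u ∷ _) {zero} {suc j} eq =
    contradiction eq (All.lookup u (∈-lookup {xs = L} j))
  lookup-injective {x ∷ L} (u ∷ _) {suc i} {zero} eq =
    contradiction (sym eq) (All.lookup u (∈-lookup {xs = L} i))
  lookup-injective (_ ∷ us) {suc i} {suc j} eq = cong suc (lookup-injective us eq)

  -- Breaking one block after another reduces the claim to positions in a list without repetitions.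
  vertex-injective : ∀ {t q L} (st : St t q L) → Injective _≡_ _≡_ (vertex st)
  vertex-injective (start p) {inj₂ i} {inj₂ j} eq = cong inj₂ (lookup-injective (St-unique (start p)) eq)
  vertex-injective (start p) {inj₁ (inj₁ ())}
  vertex-injective (start p) {inj₁ (inj₂ ())}
  vertex-injective (start p) {inj₂ _} {inj₁ (inj₁ ())}
  vertex-injective (start p) {inj₂ _} {inj₁ (inj₂ ())}
  vertex-injective (tri a b c ab bc ca st) {y} {z} eq =
    ≡.trans (sym (close-open₃ y)) (≡.trans (cong close₃ (vertex-injective st
      (≡.trans (sym (vertex-open₃ st y)) (≡.trans eq (vertex-open₃ st z))))) (close-open₃ z))
  vertex-injective (quad a b c d ab bc cd da st) {y} {z} eq =
    ≡.trans (sym (close-open₄ y)) (≡.trans (cong close₄ (vertex-injective st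
      (≡.trans (sym (vertex-open₄ st y)) (≡.trans eq (vertex-open₄ st z))))) (close-open₄ z))

  -- In the shape `full` one of the s quadrilaterals is given up to serve as the subgraph on four
  -- vertices.
  pop-quad : ∀ {t q L} → St t (suc q) L → ∃ λ a → ∃ λ b → ∃ λ c → ∃ λ d →
    a ~ b × b ~ c × c ~ d × d ~ a × St t q (a ∷ b ∷ c ∷ d ∷ L)
  pop-quad (quad a b c d ab bc cd da st) = a , b , c , d , ab , bc , cd , da , st
  pop-quad {L = L} (tri x y z xy yz zx st) with pop-quad st
  ... | a , b , c , d , ab , bc , cd , da , st′ = a , b , c , d , ab , bc , cd , da ,
        tri x y z xy yz zx (St-↭ (++-swap (a ∷ b ∷ c ∷ d ∷ []) (x ∷ y ∷ z ∷ []) L) st′)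

module _ {n : ℕ} (G : Graph n) where

  adj : Fin n → Fin n → Bool
  adj x y = ⌊ adj? G x y ⌋

  open Packings adj
  open Extract adj

  ~⇒Adj : ∀ {x y} → x ~ y → Adj G x y
  ~⇒Adj {x} {y} eq with adj? G x y
  ... | yes p = p

  Adj⇒~ : ∀ {x y} → Adj G x y → x ~ y
  Adj⇒~ {x} {y} p with adj? G x y
  ... | yes _ = refl
  ... | no ¬p = contradiction p ¬p

  triangles-ok : ∀ {t q L} (st : St t q L) i → IsTriangle G (triangles st i)
  triangles-ok (tri a b c ab bc ca st) zero = ~⇒Adj ab , ~⇒Adj bc , ~⇒Adj ca
  triangles-ok (tri a b c ab bc ca st) (suc i) = triangles-ok st i
  triangles-ok (quad a b c d ab bc cd da st) i = triangles-ok st i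

  quads-ok : ∀ {t q L} (st : St t q L) j → IsQuadrilateral G (quads st j)
  quads-ok (tri a b c ab bc ca st) j = quads-ok st j
  quads-ok (quad a b c d ab bc cd da st) zero = ~⇒Adj ab , ~⇒Adj bc , ~⇒Adj cd , ~⇒Adj da
  quads-ok (quad a b c d ab bc cd da st) (suc j) = quads-ok st j

  packing : ∀ {t q a b c d} → St t q (a ∷ b ∷ c ∷ d ∷ []) →
    4 ≤ edgesAmong4 G (lookup (a ∷ b ∷ c ∷ d ∷ [])) → Packing G t q
  packing {t} {q} {a} {b} {c} {d} st dense = record
    { tri = triangles st
    ; quad = quads st
    ; D = lookup (a ∷ b ∷ c ∷ d ∷ [])
    ; triOK = triangles-ok st
    ; quadOK = quads-ok st
    ; DOK = dense
    ; disjoint = λ {y} {z} eq → vertex-injective st (≡.trans (sym (same y)) (≡.trans eq (same z)))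
    }
    where
    same : ∀ z → allVerts (triangles st) (quads st) (lookup (a ∷ b ∷ c ∷ d ∷ [])) z ≡ vertex st z
    same (inj₁ (inj₁ _)) = refl
    same (inj₁ (inj₂ _)) = refl
    same (inj₂ _) = refl

  adj-sym : ∀ x y → adj x y ≡ adj y x
  adj-sym x y with adj? G x y | adj? G y x
  ... | yes _ | yes _ = refl
  ... | no _ | no _ = refl
  ... | yes p | no ¬q = contradiction (Graph.sym G p) ¬q
  ... | no ¬p | yes q = contradiction (Graph.sym G q) ¬p

  adj-irr : ∀ x → adj x x ≡ false
  adj-irr x with adj? G x x
  ... | yes p = contradiction p (irrefl G)
  ... | no _ = refl

  square-dense : ∀ a b c d → a ~ b → b ~ c → c ~ d → d ~ a → 4 ≤ edgesAmong4 G (lookup (a ∷ b ∷ c ∷ d ∷ []))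
  square-dense a b c d ab bc cd da rewrite ab | bc | cd | ≡.trans (adj-sym a d) da with adj a c | adj b d
  ... | true | true = s≤s (s≤s (s≤s (s≤s z≤n)))
  ... | true | false = s≤s (s≤s (s≤s (s≤s z≤n)))
  ... | false | true = s≤s (s≤s (s≤s (s≤s z≤n)))
  ... | false | false = s≤s (s≤s (s≤s (s≤s z≤n)))

  paw-dense : ∀ a b c d → a ~ b → b ~ c → c ~ a → a ~ d → 4 ≤ edgesAmong4 G (lookup (a ∷ b ∷ c ∷ d ∷ []))
  paw-dense a b c d ab bc ca ad rewrite ab | bc | ≡.trans (adj-sym a c) ca | ad = s≤s (s≤s (s≤s (s≤s z≤n)))

  deg-hits : ∀ x → deg G x ≡ hits x (allFin n)
  deg-hits x = count-tabulate id
    where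
    count-tabulate : ∀ {m} (f : Fin m → Fin n) → ∣ Vec.tabulate (adj x ∘ f) ∣ ≡ hits x (tabulate f)
    count-tabulate {zero} f = refl
    count-tabulate {suc m} f with adj x (f zero)
    ... | true = cong suc (count-tabulate (f ∘ suc))
    ... | false = count-tabulate (f ∘ suc)

-- The order of the graph and the conclusion

extent-size : ∀ r s → extent r s 0 ≡ 3 * r + 4 * s
extent-size zero zero = refl
extent-size zero (suc s) = ≡.trans (cong (4 +_) (extent-size zero s)) (sym (*-suc 4 s))
extent-size (suc r) s = ≡.trans (cong (3 +_) (extent-size r s)) (regroup r s)
  where
  regroup : ∀ r s → 3 + (3 * r + 4 * s) ≡ 3 * suc r + 4 * s
  regroup = solve-∀

theorem1 : (r s : ℕ) → 1 ≤ r → 1 ≤ s →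
    (G : Graph (3 * r + 4 * s)) →
    σ₂≥ G ((3 * r + 4 * s) + r) →
    Packing G r (s ∸ 1)
theorem1 r (suc s) _ _ G σ = conclude (pack x₀ (sym (extent-size r (suc s))) pairs (adj G) ore
    (λ x y _ _ → ∈-cartesianProduct⁺ (∈-allFin x) (∈-allFin y)))
  where
  n = 3 * r + 4 * suc s
  pairs = cartesianProduct (allFin n) (allFin n)
  x₀ : Fin n
  -- A vertex exists since there is at least one quadrilateral's worth of vertices.
  x₀ = (3 * r) ↑ʳ zero
  -- The bound n + r is four for each of the r + s blocks: the source of the average of four edges
  -- per pair and block.
  regroup : ∀ r s → 3 * r + 4 * s + r ≡ 4 * (r + s)
  regroup = solve-∀
  ore : Ore (adj G) (4 * (r + suc s))
  ore = record
    { symmetric = adj-sym G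
    ; irreflexive = adj-irr G
    ; heavy = λ x y x≢y xy → ≤-trans (≤-reflexive (sym (regroup r (suc s)))) (≤-trans
        (σ x y x≢y λ p → contradiction (≡.trans (sym xy) (Adj⇒~ G p)) λ ())
        (≤-reflexive (cong₂ _+_ (deg-hits G x) (deg-hits G y))))
    }
  open Engine (adj G) (adj-sym G) r (suc s) (Ore.heavy ore)
  open Extract (adj G)
  conclude : Has paw ⊎ Has full → Packing G r s
  conclude (inj₁ (has {t} {q} te qe v st (ab ∷ bc ∷ ca ∷ ad ∷ [])))
    with refl ← ≡.trans (sym (+-identityʳ t)) te | refl ← suc-injective (≡.trans (+-comm 1 q) qe)
    = packing G st (paw-dense G _ _ _ _ ab bc ca ad)
  conclude (inj₂ (has {t} {q} te qe v st _))
    with refl ← ≡.trans (sym (+-identityʳ t)) te | refl ← ≡.trans (sym (+-identityʳ q)) qe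
    with a , b , c , d , ab , bc , cd , da , st′ ← pop-quad st
    = packing G st′ (square-dense G a b c d ab bc cd da)
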